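{- Let $B=K_{\aleph_0}$ be the countably infinite complete graph. For $k\in\mathbb N$, let $G_1,\dots,G_k\subseteq B$ be pairwise vertex disjoint graphs, each of which is a copy of $G_{\mathrm{star}}$ or of $G_{\mathrm{cli}}$. Then Maker has a winning strategy in the pattern preserving game $\mathrm{MB}_{\mathrm{pat}}(G_1,\dots,G_k)$.
   Context: For $j\in\mathbb N=\{1,2,\dots\}$, $K_j$ and $S_j$ denote the clique and the star on $j$ vertices, respectively. $G_{\mathrm{cli}}$ is the graph consisting of pairwise vertex disjoint cliques $\{K_j\}_{j\in\mathbb N}$ (one for each $j$), and $G_{\mathrm{star}}$ is the graph consisting of pairwise vertex disjoint stars $\{S_j\}_{j\in\mathbb N}$ (one for each $j$). Two players, Maker and Breaker, alternately claim previously unclaimed edges of $B=K_{\aleph_0}$, one edge per move; Maker moves first and the game lasts $\omega$ moves. Given graphs $G_1,\dots,G_k\subseteq B$, Maker wins the pattern preserving game $\mathrm{MB}_{\mathrm{pat}}(G_1,\dots,G_k)$ if there is a copy $K\subseteq B$ of $K_{\aleph_0}$, all of whose edges have been claimed by Maker, such that there exists a bijection $f\colon V(B)\to V(K)$ with $$\{x,y\}\in E(G_i)\iff\{f(x),f(y)\}\in E(G_i)\quad\text{for all }x,y\in V(B)\text{ and all }i\in\{1,\dots,k\}.$$ Otherwise Breaker wins. -}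

module Defs where

open import Level using (0ℓ)
open import Data.Nat using (ℕ; suc; _*_; _<_)
open import Data.Fin using (Fin; toℕ)
open import Data.List using (List; applyDownFrom)
open import Data.List.Membership.Propositional using (_∉_)
open import Data.Product using (Σ; Σ-syntax; ∃-syntax; _×_; _,_; proj₁)
open import Data.Sum using (_⊎_; inj₁; inj₂; swap)
open import Function using (_∘_; _⇔_)
open import Function.Definitions using (Injective)
open import Relation.Binary.Core using (Rel)
open import Relation.Binary.Definitions using (Symmetric)
open import Relation.Binary.PropositionalEquality using (_≡_; _≢_; refl; ≢-sym)
open import Relation.Nullary using (¬_)
open import Relation.Unary using (Pred)

record Graph : Set₁ where
  field
    Vertex   : Set
    Adj      : Rel Vertex 0ℓ
    adj-sym  : Symmetric Adj
    adj-irr  : ∀ {x} → ¬ Adj x x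

complete : Set → Graph
complete A = record
  { Vertex  = A
  ; Adj     = _≢_
  ; adj-sym = ≢-sym
  ; adj-irr = λ x≢x → x≢x refl
  }

clique : ℕ → Graph
clique j = complete (Fin j)

-- The star on j vertices in total: centre 0 and j ∸ 1 leaves.
star : ℕ → Graph
star j = record
  { Vertex  = Fin j
  ; Adj     = λ x y → (toℕ x ≡ 0 × toℕ y ≢ 0) ⊎ (toℕ y ≡ 0 × toℕ x ≢ 0)
  ; adj-sym = swap
  ; adj-irr = λ { (inj₁ (p , q)) → q p ; (inj₂ (p , q)) → q p }
  }

data DisjointUnionAdj (H : ℕ → Graph) : Rel (Σ ℕ (Graph.Vertex ∘ H)) 0ℓ where
  within : ∀ j {x y} → Graph.Adj (H j) x y → DisjointUnionAdj H (j , x) (j , y)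

disjointUnion : (ℕ → Graph) → Graph
disjointUnion H = record
  { Vertex  = Σ ℕ (Graph.Vertex ∘ H)
  ; Adj     = DisjointUnionAdj H
  ; adj-sym = λ { (within j a) → within j (Graph.adj-sym (H j) a) }
  ; adj-irr = λ { (within j a) → Graph.adj-irr (H j) a }
  }

-- One component on j vertices for each j ≥ 1.
G-cli G-star : Graph
G-cli  = disjointUnion (clique ∘ suc)
G-star = disjointUnion (star ∘ suc)

Kℵ₀ : Graph
Kℵ₀ = complete ℕ

-- Subgraphs of the board B, the complete graph with vertex set ℕ.
record Subgraph : Set₁ where
  field
    V       : Pred ℕ 0ℓ
    E       : Rel ℕ 0ℓ
    E-sym   : Symmetric E
    E-irr   : ∀ {x} → ¬ E x x
    E⇒V     : ∀ {x y} → E x y → V x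

open Subgraph public using (V; E)

record BijectiveOnto {A : Set} (f : A → ℕ) (P : Pred ℕ 0ℓ) : Set where
  field
    into      : ∀ x → P (f x)
    injective : Injective _≡_ _≡_ f
    onto      : ∀ {v} → P v → ∃[ x ] f x ≡ v

_IsCopyOf_ : Subgraph → Graph → Set
S IsCopyOf H =
  Σ[ f ∈ (Graph.Vertex H → ℕ) ]
    BijectiveOnto f (V S) × (∀ x y → Graph.Adj H x y ⇔ E S (f x) (f y))

-- An edge {lo , hi} of B.  Ordering the endpoints, with an irrelevant proof,
-- makes _≡_ on Edge coincide with equality of unordered pairs.
record Edge : Set where
  constructor edge
  field
    lo hi  : ℕ
    .lo<hi : lo < hi

Joins : Edge → ℕ → ℕ → Set
Joins e x y = (Edge.lo e ≡ x × Edge.hi e ≡ y) ⊎ (Edge.lo e ≡ y × Edge.hi e ≡ x)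

-- The edges claimed so far by either player, most recent first.  Since Maker
-- starts and the players alternate, this determines who claimed which edge.
History : Set
History = List Edge

-- A strategy answers every finite history with an unclaimed edge.  Defining it
-- also on unreachable histories is harmless: finitely many edges never exhaust B.
Strategy : Set
Strategy = (h : History) → ∃[ e ] e ∉ h

-- p n is the edge claimed in move n; Maker makes the moves 0, 2, 4, …
Play : Set
Play = ℕ → Edge

history : Play → ℕ → History
history = applyDownFrom

Legal : Play → Set
Legal p = ∀ n → p n ∉ history p n

MakerFollows : Strategy → Play → Set
MakerFollows σ p = ∀ n → p (2 * n) ≡ proj₁ (σ (history p (2 * n)))

ClaimedByMaker : Play → ℕ → ℕ → Set
ClaimedByMaker p x y = ∃[ n ] Joins (p (2 * n)) x y

MakerWins : ∀ {k} → (Fin k → Subgraph) → Play → Set₁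
MakerWins G p =
  Σ[ K ∈ Subgraph ]
    K IsCopyOf Kℵ₀ ×
    (∀ {x y} → E K x y → ClaimedByMaker p x y) ×
    (Σ[ f ∈ (ℕ → ℕ) ]
      BijectiveOnto f (V K) ×
      (∀ x y i → E (G i) x y ⇔ E (G i) (f x) (f y)))

MakerHasWinningStrategy : ∀ {k} → (Fin k → Subgraph) → Set₁
MakerHasWinningStrategy G =
  Σ[ σ ∈ Strategy ] (∀ p → Legal p → MakerFollows σ p → MakerWins G p)

module Submission where

-- Maker grows a finite tree in which every path from the root is a clique of her edges.  Along a path, stage s
-- consists of the centre of one component of the type prescribed for s (any vertex, if the component is a clique),
-- followed by s further vertices of that component.  If there are K types, every vertex gets at most 3K + 1
-- children; only after a complete stage may some of them be missing, and then there is a gap for a new component.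
-- By the pigeonhole principle the tree contains a subtree with four children per node all of whose gaps have the
-- same type.  Maker takes a new, huge component of that type.  Pairing up siblings, she joins its centre to a
-- subtree with two children per node, and then, one at a time, joins further vertices to the centre and, again by
-- pairing, to a path of the remaining binary tree, at the end of which they are added.  As the room for this is
-- bounded, eventually a long chain arises above some gap, and its vertices are arranged to fill this gap.  Thus the
-- tree grows for ever with bounded degrees, and by König's lemma it has an infinite branch.  Every component, and
-- every vertex outside all components, is then mapped into a stage of its own.

open import Defs
open import Level using (0ℓ)
open import Axiom.ExcludedMiddle using (ExcludedMiddle)
open import Data.Empty.Irrelevant using (⊥-elim)
open import Data.Fin using (Fin; zero; suc; toℕ; inject≤)
import Data.Fin.Properties as Fin
open import Data.List using (List; []; _∷_; _++_; length; map; concatMap; filter)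
import Data.List.Membership.DecPropositional as DecMembership
open import Data.List.Membership.Propositional using (_∈_; _∉_; find)
open import Data.List.Membership.Propositional.Properties using (∈-++⁺ˡ; ∈-++⁺ʳ; ∈-filter⁻)
import Data.List.Membership.Setoid.Properties as SetoidMembership
open import Data.List.Properties using (length-++; ++-identityʳ; map-++; ++-assoc)
open import Data.List.Relation.Binary.Permutation.Propositional
  using (_↭_; refl; prep; swap; trans; ↭-sym; ↭-refl; ↭-reflexive; ↭⇒↭ₛ)
open import Data.List.Relation.Binary.Permutation.Propositional.Properties
  using (↭-length; All-resp-↭; ∈-resp-↭; shift; shifts; ++⁺ˡ; ++⁺ʳ)
  renaming (++⁺ to ↭-++⁺)
import Data.List.Relation.Binary.Permutation.Setoid.Properties as SetoidPermutation
open import Data.List.Relation.Binary.Sublist.Propositional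
  using (_⊆_; []; _∷_; _∷ʳ_; minimum; ⊆-refl; ⊆-trans)
open import Data.List.Relation.Binary.Sublist.Propositional.Properties
  using (All-resp-⊆; Any-resp-⊆; filter-⊆; map⁺; length-mono-≤)
  renaming (++⁺ˡ to ⊆-++⁺ˡ; ++⁺ʳ to ⊆-++⁺ʳ; ++⁺ to ⊆-++⁺)
open import Data.List.Relation.Unary.All as All using (All; []; _∷_)
import Data.List.Relation.Unary.All.Properties as All
open import Data.List.Relation.Unary.AllPairs as AllPairs using (AllPairs; []; _∷_)
import Data.List.Relation.Unary.AllPairs.Properties as AllPairs
open import Data.List.Relation.Unary.Any as Any using (Any; here; there; index; any?)
open import Data.List.Relation.Unary.Unique.Propositional using (Unique)
open import Data.Maybe as Maybe using (Maybe; just; nothing; _>>=_)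
open import Data.Nat
  using (ℕ; zero; suc; _+_; _*_; _≤_; _<_; z≤n; s≤s; _≟_; _≤′_; ≤′-refl; ≤′-step; NonZero)
open import Data.Nat.DivMod using (_mod_; m%n<n; [m+kn]%n≡m%n; m<n⇒m%n≡m)
open import Data.Nat.Properties
  using (*-cancelʳ-≡; *-monoʳ-≤; *-suc; +-assoc; +-cancelˡ-<; +-cancelˡ-≡; +-comm; +-identityʳ; +-mono-≤;
         +-monoʳ-≤; +-monoˡ-≤; +-suc; 1+n≢n; <-cmp; <-irrefl; <-≤-trans; <⇒≢; <⇒≱; m<n⇒m<1+n; m≤m*n;
         m≤m+n; m≤n+m; m≤n⇒∃[o]m+o≡n; n<1+n; n≤1+n; ≡-irrelevant; ≤-pred; ≤-refl; ≤-reflexive; ≤-trans;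
         ≤⇒≤′; ≤∧≢⇒<; module ≤-Reasoning)
open import Data.Product using (Σ; Σ-syntax; ∃-syntax; _×_; _,_; proj₁; proj₂)
open import Data.Product.Properties using (,-injectiveʳ-UIP)
open import Data.Sum as Sum using (_⊎_; inj₁; inj₂)
open import Data.Unit using (⊤; tt)
open import Data.Vec using (Vec; []; _∷_; toList; take; drop)
open import Data.Vec.Properties using (take++drop≡id; toList-++)
open import Function using (_∘_; id; _⇔_; mk⇔)
open import Function.Bundles using (Equivalence)
open import Function.Definitions using (Injective)
open import Relation.Binary.Core using (Rel)
open import Relation.Binary.Definitions using (DecidableEquality; tri<; tri≈; tri>)
open import Relation.Binary.PropositionalEquality
  using (_≡_; _≢_; refl; sym; cong; cong₂; subst; subst₂; setoid) renaming (trans to ≡-trans)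
open import Relation.Nullary using (¬_; Dec; yes; no; contradiction)
open import Relation.Nullary.Decidable using (¬?; decidable-stable)
open import Relation.Unary using (_⊥_)

-- Pigeonhole arguments and facts about lists

avoid : {A : Set} → DecidableEquality A → ∀ {n} (f : Fin n → A) → Injective _≡_ _≡_ f →
        (ys : List A) → length ys < n → ∃[ i ] f i ∉ ys
avoid _≟ᴬ_ f f-inj ys ys<n with Fin.any? (λ i → ¬? (f i ∈? ys))
  where open DecMembership _≟ᴬ_ using (_∈?_)
... | yes found = found
-- If every `f i` occurred in `ys`, its positions would give an injection of `Fin n` into
-- `Fin (length ys)`.
... | no none = contradiction (Fin.injective⇒≤ index-inj) (<⇒≱ ys<n)
  where
  open DecMembership _≟ᴬ_ using (_∈?_)
  hit : ∀ i → f i ∈ ys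
  hit i = decidable-stable (f i ∈? ys) (λ miss → none (i , miss))
  index-inj : Injective _≡_ _≡_ (index ∘ hit)
  index-inj eq = f-inj (SetoidMembership.index-injective (setoid _) (hit _) (hit _) eq)

AllPairs-resp-⊆ : {A : Set} {R : A → A → Set} {xs ys : List A} →
                  xs ⊆ ys → AllPairs R ys → AllPairs R xs
AllPairs-resp-⊆ [] [] = []
AllPairs-resp-⊆ (y ∷ʳ τ) (_ ∷ rs) = AllPairs-resp-⊆ τ rs
AllPairs-resp-⊆ (refl ∷ τ) (r ∷ rs) = All-resp-⊆ τ r ∷ AllPairs-resp-⊆ τ rs

Unique-resp-↭ : {xs ys : List ℕ} → xs ↭ ys → Unique xs → Unique ys
Unique-resp-↭ = SetoidPermutation.Unique-resp-↭ (setoid ℕ) ∘ ↭⇒↭ₛ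

∉⇒All≢ : {A : Set} {x : A} {ys : List A} → x ∉ ys → All (x ≢_) ys
∉⇒All≢ x∉ = All.tabulate (λ y∈ → λ { refl → x∉ y∈ })

length-filter-¬ : {A : Set} {Q : A → Set} (Q? : ∀ x → Dec (Q x)) (xs : List A) →
                  length (filter Q? xs) + length (filter (¬? ∘ Q?) xs) ≡ length xs
length-filter-¬ Q? [] = refl
length-filter-¬ Q? (x ∷ xs) with Q? x
... | yes _ = cong suc (length-filter-¬ Q? xs)
... | no  _ = ≡-trans (+-suc _ _) (cong suc (length-filter-¬ Q? xs))

module _ {A : Set} where
  Alike₄ : (A → ℕ) → List A → Set
  Alike₄ τ xs = Σ[ a ∈ A ] Σ[ b ∈ A ] Σ[ c ∈ A ] Σ[ d ∈ A ]
    (a ∷ b ∷ c ∷ d ∷ []) ⊆ xs × τ b ≡ τ a × τ c ≡ τ a × τ d ≡ τ a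

  -- By induction on the number of types: if type `m` occurs at most three times, dropping it is
  -- paid for by the 3 that the bound loses; otherwise four of its occurrences are at hand.
  alike₄ : ∀ m (τ : A → ℕ) xs → All (λ x → τ x < m) xs → 3 * m < length xs → Alike₄ τ xs
  alike₄ zero τ (x ∷ xs) (() ∷ _) _
  alike₄ (suc m) τ xs τ< big = split (filter top? xs) refl
    where
    top? = λ x → τ x ≟ m
    rest = filter (¬? ∘ top?) xs

    rest< : All (λ x → τ x < m) rest
    rest< = All.tabulate λ x∈ → let (x∈xs , τx≢m) = ∈-filter⁻ (¬? ∘ top?) x∈ in
      ≤∧≢⇒< (≤-pred (All.lookup τ< x∈xs)) τx≢m

    few : length (filter top? xs) ≤ 3 → Alike₄ τ xs
    few ≤3 = let (a , b , c , d , τ⊆ , eqs) = alike₄ m τ rest rest< rest-big in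
      a , b , c , d , ⊆-trans τ⊆ (filter-⊆ (¬? ∘ top?) xs) , eqs
      where
      rest-big : 3 * m < length rest
      rest-big = +-cancelˡ-< 3 _ _ (begin-strict
        3 + 3 * m                                    ≡⟨ sym (*-suc 3 m) ⟩
        3 * suc m                                    <⟨ big ⟩
        length xs                                    ≡⟨ sym (length-filter-¬ top? xs) ⟩
        length (filter top? xs) + length rest        ≤⟨ +-monoˡ-≤ _ ≤3 ⟩
        3 + length rest                              ∎)
        where open ≤-Reasoning

    split : ∀ ys → filter top? xs ≡ ys → Alike₄ τ xs
    split [] eq = few (subst (λ l → length l ≤ 3) (sym eq) z≤n)
    split (_ ∷ []) eq = few (subst (λ l → length l ≤ 3) (sym eq) (s≤s z≤n))
    split (_ ∷ _ ∷ []) eq = few (subst (λ l → length l ≤ 3) (sym eq) (s≤s (s≤s z≤n)))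
    split (_ ∷ _ ∷ _ ∷ []) eq = few (subst (λ l → length l ≤ 3) (sym eq) ≤-refl)
    split (a ∷ b ∷ c ∷ d ∷ ys) eq
      with aeq ∷ beq ∷ ceq ∷ deq ∷ _ ← subst (All (λ x → τ x ≡ m)) eq (All.all-filter top? xs)
      = a , b , c , d ,
        ⊆-trans (refl ∷ refl ∷ refl ∷ refl ∷ minimum ys) (subst (_⊆ xs) eq (filter-⊆ top? xs)) ,
        ≡-trans beq (sym aeq) , ≡-trans ceq (sym aeq) , ≡-trans deq (sym aeq)

-- Edges, positions and finite forcing

_≟ᴱ_ : DecidableEquality Edge
edge a b _ ≟ᴱ edge c d _ with a ≟ c | b ≟ d
... | yes refl | yes refl = yes refl
... | no a≢c   | _        = no (a≢c ∘ cong Edge.lo)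
... | yes _    | no b≢d   = no (b≢d ∘ cong Edge.hi)

open DecMembership _≟ᴱ_ using () renaming (_∈?_ to _∈ᴱ?_)

-- The value of spoke x x is junk, chosen so that spoke x is injective.
spoke : ℕ → ℕ → Edge
spoke x y with <-cmp x y
... | tri< x<y _ _ = edge x y x<y
... | tri≈ _ _ _   = edge (suc x) (suc (suc x)) (n<1+n _)
... | tri> _ _ y<x = edge y x y<x

spoke-injective : ∀ x → Injective _≡_ _≡_ (spoke x)
spoke-injective x {y} {z} eq with <-cmp x y | <-cmp x z
... | tri< _ _ _     | tri< _ _ _     = cong Edge.hi eq
... | tri< _ _ _     | tri≈ _ _ _     = contradiction (sym (cong Edge.lo eq)) 1+n≢n
... | tri< _ _ _     | tri> _ x≢z _   = contradiction (cong Edge.lo eq) x≢z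
... | tri≈ _ _ _     | tri< _ _ _     = contradiction (cong Edge.lo eq) 1+n≢n
... | tri≈ _ refl _  | tri≈ _ refl _  = refl
... | tri≈ _ _ _     | tri> _ _ _     = contradiction (sym (cong Edge.hi eq)) (<⇒≢ (m<n⇒m<1+n (n<1+n _)))
... | tri> _ x≢y _   | tri< _ _ _     = contradiction (sym (cong Edge.lo eq)) x≢y
... | tri> _ _ _     | tri≈ _ _ _     = contradiction (cong Edge.hi eq) (<⇒≢ (m<n⇒m<1+n (n<1+n _)))
... | tri> _ _ _     | tri> _ _ _     = cong Edge.lo eq

spoke-joins : ∀ {x y} → x ≢ y → Joins (spoke x y) x y
spoke-joins {x} {y} x≢y with <-cmp x y
... | tri< _ _ _   = inj₁ (refl , refl)
... | tri≈ _ x≡y _ = contradiction x≡y x≢y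
... | tri> _ _ _   = inj₂ (refl , refl)

Joins-sym : ∀ {e x y} → Joins e x y → Joins e y x
Joins-sym = Sum.swap

Joins-irrefl : ∀ {e x y} → Joins e x y → x ≢ y
Joins-irrefl {edge _ _ lo<hi} (inj₁ (refl , refl)) refl = ⊥-elim (<-irrefl refl lo<hi)
Joins-irrefl {edge _ _ lo<hi} (inj₂ (refl , refl)) refl = ⊥-elim (<-irrefl refl lo<hi)

fresh-edge : (h : History) → ∃[ e ] e ∉ h
fresh-edge h =
  let (i , new) = avoid _≟ᴱ_ {suc (length h)} (spoke 0 ∘ toℕ) (Fin.toℕ-injective ∘ spoke-injective 0) h ≤-refl
  in spoke 0 (toℕ i) , new

-- Rounds consisting of a move of Maker and the reply of Breaker, most recent first.
Position : Set
Position = List (Edge × Edge)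

moves : Position → History
moves [] = []
moves ((m , b) ∷ P) = b ∷ m ∷ moves P

touched : Position → List ℕ
touched [] = []
touched ((m , b) ∷ P) = Edge.lo b ∷ Edge.hi b ∷ Edge.lo m ∷ Edge.hi m ∷ touched P

length-touched : ∀ P → length (touched P) ≡ 4 * length P
length-touched [] = refl
length-touched (_ ∷ P) = ≡-trans (cong (4 +_) (length-touched P)) (sym (*-suc 4 (length P)))

ends-touched : ∀ P {e} → e ∈ moves P → Edge.lo e ∈ touched P × Edge.hi e ∈ touched P
ends-touched (_ ∷ P) (here refl) = here refl , there (here refl)
ends-touched (_ ∷ P) (there (here refl)) = there (there (here refl)) , there (there (there (here refl)))
ends-touched (_ ∷ P) (there (there e∈)) = let (l , h) = ends-touched P e∈ in
  there (there (there (there l))) , there (there (there (there h)))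

spoke-unclaimed : ∀ {P x y} → x ∉ touched P → x ≢ y → spoke x y ∉ moves P
spoke-unclaimed {P} x∉ x≢y e∈ with spoke-joins x≢y
... | inj₁ (lo≡x , _) = x∉ (subst (_∈ touched P) lo≡x (proj₁ (ends-touched P e∈)))
... | inj₂ (_ , hi≡x) = x∉ (subst (_∈ touched P) hi≡x (proj₂ (ends-touched P e∈)))

Has : Position → Edge → Set
Has P e = Any (λ r → proj₁ r ≡ e) P

Joined : Position → ℕ → ℕ → Set
Joined P x y = Any (λ r → Joins (proj₁ r) x y) P

Joined-sym : ∀ {P x y} → Joined P x y → Joined P y x
Joined-sym = Any.map (λ {r} → Joins-sym {proj₁ r})

Joined-irrefl : ∀ {P x y} → Joined P x y → x ≢ y
Joined-irrefl (here {r} j) = Joins-irrefl {proj₁ r} j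
Joined-irrefl (there j) = Joined-irrefl j

Has⇒Joined : ∀ {P x y} → x ≢ y → Has P (spoke x y) → Joined P x y
Has⇒Joined x≢y = Any.map (λ { refl → spoke-joins x≢y })

-- A well-founded game tree: Maker reaches `Φ` after finitely many rounds, possibly none, against
-- all legal replies.
data Force (Φ : Position → Set) (P : Position) : Set where
  done : Φ P → Force Φ P
  move : ∀ m → m ∉ moves P → (∀ b → b ∉ m ∷ moves P → Force Φ ((m , b) ∷ P)) → Force Φ P

bind : ∀ {Φ Ψ P} → Force Φ P → (∀ {P'} → Φ P' → Force Ψ P') → Force Ψ P
bind (done φ) k = k φ
bind (move m m∉ f) k = move m m∉ λ b b∉ → bind (f b b∉) k

flatten : List (ℕ × ℕ) → List ℕ
flatten [] = []
flatten ((v , w) ∷ ps) = v ∷ w ∷ flatten ps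

Either : (ℕ → Set) → ℕ × ℕ → Set
Either S (v , w) = S v ⊎ S w

-- Pairing strategies

-- Once Breaker has taken the edge to `v`, Maker must take the one to its `partner`. The pair is
-- removed from the list, and `restore` extends a win on the rest to the whole list.
record Spoilt (v : ℕ) (ps : List (ℕ × ℕ)) : Set₁ where
  field
    partner  : ℕ
    others   : List (ℕ × ℕ)
    contents : v ∷ partner ∷ flatten others ↭ flatten ps
    restore  : ∀ {S : ℕ → Set} → S partner → All (Either S) others → All (Either S) ps

spoil : ∀ {v} ps → v ∈ flatten ps → Spoilt v ps
spoil ((v , w) ∷ ps) (here refl) = record { contents = refl ; restore = λ s ss → inj₂ s ∷ ss }
spoil ((v , w) ∷ ps) (there (here refl)) =
  record { contents = swap w v refl ; restore = λ s ss → inj₁ s ∷ ss }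
spoil {u} ((v , w) ∷ ps) (there (there u∈)) = record
  { contents = trans (shifts (u ∷ _ ∷ []) (v ∷ w ∷ [])) (prep v (prep w contents))
  ; restore  = λ { s (p ∷ ss) → p ∷ restore s ss } }
  where open Spoilt (spoil ps u∈)

module Pairing (E : ℕ → Edge) (E-injective : Injective _≡_ _≡_ E) where

  Free : Position → ℕ → Set
  Free P v = E v ∉ moves P

  Won : ℕ → List (ℕ × ℕ) → Position → Position → Set
  Won n ps P P' = P ⊆ P' × length P' ≤ n + length P × All (Either (Has P' ∘ E)) ps

  still-free : ∀ {P u b vs} → All (u ≢_) vs → (∀ {v} → v ∈ vs → E v ≢ b) →
               All (Free P) vs → All (Free ((E u , b) ∷ P)) vs
  still-free u∉ b≢ free = All.tabulate λ v∈ →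
    λ { (here eq) → b≢ v∈ eq
      ; (there (here eq)) → All.lookup u∉ v∈ (sym (E-injective eq))
      ; (there (there e∈)) → All.lookup free v∈ e∈ }

  after-move : ∀ {n u b ps P P'} → Won n ps ((E u , b) ∷ P) P' →
               Won (suc n) ps P P' × Has P' (E u)
  after-move {n} {P = P} {P'} (sub , len , won) =
    (⊆-trans (_ ∷ʳ ⊆-refl) sub , subst (length P' ≤_) (+-suc n (length P)) len , won) , Any-resp-⊆ sub (here refl)

  weaken : ∀ {m n ps P P'} → m ≤ n → Won m ps P P' → Won n ps P P'
  weaken m≤n (sub , len , won) = sub , ≤-trans len (+-monoˡ-≤ _ m≤n) , won

  mutual
    -- No pair is under attack, so Maker opens the first one herself. The number `n` bounds the
    -- rounds and also carries the recursion, since `others` is no subterm of the list of pairs.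
    resolve : ∀ n ps P → length (flatten ps) ≤ n → Unique (flatten ps) → All (Free P) (flatten ps) →
              Force (Won n ps P) P
    resolve n [] P _ _ _ = done (⊆-refl , m≤n+m _ n , [])
    resolve (suc (suc n)) ((v , w) ∷ ps) P (s≤s (s≤s len)) ((_ ∷ v∉) ∷ _ ∷ uniq) (fv ∷ _ ∷ free) =
      bind (resolve-urgent n v ps P len (v∉ ∷ uniq) (fv ∷ free)) λ ((sub , len , won) , has) →
      done (weaken (n≤1+n _) (sub , len , inj₁ has ∷ won))

    -- The edge `E u` has no alternative left. Breaker's single reply can damage at most one
    -- remaining pair, because the vertices are distinct; its partner then becomes urgent.
    resolve-urgent : ∀ n u ps P → length (flatten ps) ≤ n →
                     Unique (u ∷ flatten ps) → All (Free P) (u ∷ flatten ps) →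
                     Force (λ P' → Won (suc n) ps P P' × Has P' (E u)) P
    resolve-urgent n u ps P len (u∉ ∷ uniq) (fu ∷ free) = move (E u) fu reply
      where
      reply : ∀ b → b ∉ E u ∷ moves P → Force (λ P' → Won (suc n) ps P P' × Has P' (E u)) ((E u , b) ∷ P)
      reply b _ with any? (λ v → E v ≟ᴱ b) (flatten ps)
      ... | no harmless =
        bind (resolve n ps _ len uniq (still-free u∉ (λ v∈ eq → harmless (Any.map (λ { refl → eq }) v∈)) free)) λ won →
        done (after-move won)
      ... | yes hit = respond n len (spoil ps (proj₁ (proj₂ v)))
        where
        v : ∃[ v ] v ∈ flatten ps × E v ≡ b
        v = find hit
        respond : ∀ n → length (flatten ps) ≤ n → Spoilt (proj₁ v) ps →
                  Force (λ P' → Won (suc n) ps P P' × Has P' (E u)) ((E u , b) ∷ P)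
        -- A damaged pair contributes two vertices to `flatten ps`, so `n` is at least 2.
        respond n len s with n | ≤-trans (≤-reflexive (↭-length (Spoilt.contents s))) len
        ... | suc (suc n) | s≤s (s≤s len') with v≢ ∷ uniq' ← Unique-resp-↭ (↭-sym (Spoilt.contents s)) uniq
                                              | _ ∷ u∉' ← All-resp-↭ (↭-sym (Spoilt.contents s)) u∉
                                              | _ ∷ free' ← All-resp-↭ (↭-sym (Spoilt.contents s)) free =
          bind (resolve-urgent n (Spoilt.partner s) (Spoilt.others s) _ len' uniq'
                 (still-free u∉' (λ x∈ eq → All.lookup v≢ x∈ (E-injective (≡-trans (proj₂ (proj₂ v)) (sym eq)))) free'))
          λ ((sub , len , won) , has) →
          done (after-move (weaken (n≤1+n (suc n)) (sub , len , Spoilt.restore s has won)))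

Has⇒Joined* : ∀ {x P} ps → x ∉ flatten ps → All (Either (Has P ∘ spoke x)) ps → All (Either (Joined P x)) ps
Has⇒Joined* [] _ [] = []
Has⇒Joined* (_ ∷ ps) x∉ (p ∷ won) =
  Sum.map (Has⇒Joined (x∉ ∘ here)) (Has⇒Joined (x∉ ∘ there ∘ here)) p ∷ Has⇒Joined* ps (x∉ ∘ there ∘ there) won

-- As `x` is untouched, all its edges are unclaimed and pairing can start. The bound on the rounds
-- later allows the size of a component to be fixed in advance.
claim-pairs : ∀ x ps {P} → x ∉ touched P → x ∉ flatten ps → Unique (flatten ps) →
  Force (λ P' → P ⊆ P' × length P' ≤ length (flatten ps) + length P × All (Either (Joined P' x)) ps) P
claim-pairs x ps {P} x∉P x∉ps uniq =
  bind (resolve _ ps P ≤-refl uniq (All.map (spoke-unclaimed x∉P) (∉⇒All≢ x∉ps)))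
  λ { (sub , len , won) → done (sub , len , Has⇒Joined* ps x∉ps won) }
  where
  open Pairing (spoke x) (spoke-injective x)

claim-pairs-and : ∀ x y ps {P} → x ∉ touched P → x ∉ y ∷ flatten ps → Unique (y ∷ flatten ps) →
  Force (λ P' → P ⊆ P' × length P' ≤ suc (length (flatten ps)) + length P ×
                Joined P' x y × All (Either (Joined P' x)) ps) P
claim-pairs-and x y ps {P} x∉P x∉ uniq =
  bind (resolve-urgent _ y ps P ≤-refl uniq (All.map (spoke-unclaimed x∉P) (∉⇒All≢ x∉)))
  λ { ((sub , len , won) , has) → done (sub , len , Has⇒Joined (x∉ ∘ here) has , Has⇒Joined* ps (x∉ ∘ there) won) }
  where
  open Pairing (spoke x) (spoke-injective x)

-- Strategies for infinitely many rounds

unmoves : History → Maybe Position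
unmoves [] = just []
unmoves (_ ∷ []) = nothing
unmoves (b ∷ m ∷ h) = Maybe.map ((m , b) ∷_) (unmoves h)

unmoves-moves : ∀ P → unmoves (moves P) ≡ just P
unmoves-moves [] = refl
unmoves-moves (_ ∷ P) rewrite unmoves-moves P = refl

positionAt : Play → ℕ → Position
positionAt p zero = []
positionAt p (suc n) = (p (2 * n) , p (suc (2 * n))) ∷ positionAt p n

moves-positionAt : ∀ p n → moves (positionAt p n) ≡ history p (2 * n)
moves-positionAt p zero = refl
moves-positionAt p (suc n) = ≡-trans
  (cong (λ h → p (suc (2 * n)) ∷ p (2 * n) ∷ h) (moves-positionAt p n))
  (cong (history p) (sym (*-suc 2 n)))

Joined⇒ClaimedByMaker : ∀ p n {x y} → Joined (positionAt p n) x y → ClaimedByMaker p x y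
Joined⇒ClaimedByMaker p (suc n) (here j) = n , j
Joined⇒ClaimedByMaker p (suc n) (there j) = Joined⇒ClaimedByMaker p n j

module Iterated {S : Position → Set} (R : ∀ {P P'} → S P → S P' → Set) (s₀ : S []) where

  Goal : ∀ {P} → S P → Position → Set
  Goal s P' = Σ (S P') (R s)

  -- Maker is to move: `state` is the last state reached, at the earlier position `origin`, and `m`
  -- is the planned move. `Pending` is the situation after Breaker's reply.
  record Ready (P : Position) : Set where
    field
      {origin} : Position
      state : S origin
      m     : Edge
      m∉    : m ∉ moves P
      reply : ∀ b → b ∉ m ∷ moves P → Force (Goal state) ((m , b) ∷ P)

  record Pending (P : Position) : Set where
    constructor pending
    field
      {origin} : Position
      state : S origin
      force : Force (Goal state) P

  module _ (step : ∀ {P} (s : S P) → Σ[ m ∈ Edge ] m ∉ moves P ×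
                     (∀ b → b ∉ m ∷ moves P → Force (Goal s) ((m , b) ∷ P))) where

    start : ∀ {P} → S P → Ready P
    start s = let (m , m∉ , k) = step s in record { state = s ; m = m ; m∉ = m∉ ; reply = k }

    ready : ∀ {P} → Pending P → Ready P
    ready (pending s (done (s' , _))) = start s'
    ready (pending s (move m m∉ k)) = record { state = s ; m = m ; m∉ = m∉ ; reply = k }

    respond : ∀ {P} → Ready P → ∀ m b → Maybe (Pending ((m , b) ∷ P))
    respond {P} r m b with m ≟ᴱ Ready.m r | b ∈ᴱ? m ∷ moves P
    ... | yes refl | no b∉ = just (pending (Ready.state r) (Ready.reply r b b∉))
    ... | _        | _     = nothing

    replay : ∀ P → Maybe (Ready P)
    replay [] = just (start s₀)
    replay ((m , b) ∷ P) = replay P >>= λ r → Maybe.map ready (respond r m b)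

    candidate : History → Maybe Edge
    candidate h = unmoves h >>= λ P → Maybe.map Ready.m (replay P)

    -- A strategy sees only the history, so the plan is reconstructed by replaying all rounds.
    -- Histories that deviate from the plan get an arbitrary fresh edge.
    strategy : Strategy
    strategy h with candidate h
    ... | nothing = fresh-edge h
    ... | just e with e ∈ᴱ? h
    ...   | yes _  = fresh-edge h
    ...   | no e∉h = e , e∉h

    strategy-moves : ∀ {P r} → replay P ≡ just r → proj₁ (strategy (moves P)) ≡ Ready.m r
    strategy-moves {P} {r} eq rewrite unmoves-moves P | eq with Ready.m r ∈ᴱ? moves P
    ... | yes m∈ = contradiction m∈ (Ready.m∉ r)
    ... | no  _  = refl

    replay-step : ∀ {P r b} → replay P ≡ just r → b ∉ Ready.m r ∷ moves P →
      ∃[ b∉ ] replay ((Ready.m r , b) ∷ P) ≡ just (ready (pending (Ready.state r) (Ready.reply r b b∉)))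
    replay-step {P} {r} {b} eq b∉ rewrite eq with Ready.m r ≟ᴱ Ready.m r | b ∈ᴱ? Ready.m r ∷ moves P
    ... | yes refl | no b∉'  = b∉' , refl
    ... | yes _    | yes b∈  = contradiction b∈ b∉
    ... | no  ≢    | _       = contradiction refl ≢

    module _ (p : Play) (legal : Legal p) (follows : MakerFollows strategy p) where

      Started : ∀ n → S (positionAt p n) → Set
      Started n s = replay (positionAt p n) ≡ just (start s)

      as-planned : ∀ n {r} → replay (positionAt p n) ≡ just r → p (2 * n) ≡ Ready.m r
      as-planned n eq = ≡-trans (follows n)
        (≡-trans (cong (proj₁ ∘ strategy) (sym (moves-positionAt p n))) (strategy-moves eq))

      reply-legal : ∀ n → p (suc (2 * n)) ∉ p (2 * n) ∷ moves (positionAt p n)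
      reply-legal n =
        subst (λ h → p (suc (2 * n)) ∉ p (2 * n) ∷ h) (sym (moves-positionAt p n)) (legal (suc (2 * n)))

      mutual
        -- `P` stays a variable tied to the play by an equation, because the planned move agrees
        -- with the one played only propositionally. The recursion descends along the game tree.
        next-state : ∀ n {P P₀} {s : S P₀} m m∉ k → P ≡ positionAt p n →
          replay P ≡ just (record { state = s ; m = m ; m∉ = m∉ ; reply = k }) →
          ∃[ n' ] Σ[ s' ∈ S (positionAt p n') ] R s s' × Started n' s'
        next-state n m m∉ k refl eq =
          let planned    = as-planned n eq
              (b∉ , eq') = replay-step eq
                             (subst (λ m → p (suc (2 * n)) ∉ m ∷ moves (positionAt p n)) planned (reply-legal n))
          in play-out (suc n) (k _ b∉) (cong (λ m → (m , p (suc (2 * n))) ∷ positionAt p n) (sym planned)) eq'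

        play-out : ∀ n {P P₀} {s : S P₀} (F : Force (Goal s) P) → P ≡ positionAt p n →
          replay P ≡ just (ready (pending s F)) →
          ∃[ n' ] Σ[ s' ∈ S (positionAt p n') ] R s s' × Started n' s'
        play-out n (done (s' , r)) refl eq = n , s' , r , eq
        play-out n (move m m∉ k) = next-state n m m∉ k

      follow-up : ∀ {n} (s : S (positionAt p n)) → Started n s →
                  ∃[ n' ] Σ[ s' ∈ S (positionAt p n') ] R s s' × Started n' s'
      follow-up {n} s eq = next-state n _ _ _ refl eq

      run : ℕ → ∃[ n ] Σ[ s ∈ S (positionAt p n) ] Started n s
      run zero = 0 , s₀ , refl
      run (suc t) = let (n , s , eq) = run t ; (n' , s' , _ , eq') = follow-up s eq in n' , s' , eq'

      run-related : ∀ t → R (proj₁ (proj₂ (run t))) (proj₁ (proj₂ (run (suc t))))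
      run-related t = let (n , s , eq) = run t in proj₁ (proj₂ (proj₂ (follow-up s eq)))

-- Trees of Maker's cliques

module Construction
  (K : ℕ) (ty : ℕ → Fin K)
  (g : Fin K → Σ ℕ (Fin ∘ suc) → ℕ)
  (g-injective : ∀ i {a b} → g i a ≡ g i b → a ≡ b) where

  hub : Fin K → ℕ → ℕ
  hub i j = g i (j , zero)

  rim : ∀ i {j} → Fin j → ℕ
  rim i {j} q = g i (j , suc q)

  W : ℕ
  W = suc (3 * K)

  -- The vertex expected next on a path; leaf s j r: a leaf of component j, with r more leaves of stage s to follow.
  data Role : Set where
    centre : ℕ → Role
    leaf   : (s j r : ℕ) → Role

  after : ℕ → ℕ → ℕ → Role
  after s j zero    = centre (suc s)
  after s j (suc r) = leaf s j r

  Label : Role → Set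
  Label (centre s)   = ℕ
  Label (leaf s j r) = Fin j

  next : ∀ ρ → Label ρ → Role
  next (centre s)   j = after s j s
  next (leaf s j r) _ = after s j r

  vertex : ∀ ρ → Label ρ → ℕ
  vertex (centre s)   j = hub (ty s) j
  vertex (leaf s j r) q = rim (ty s) q

  -- Forest n ρ: the children of a node, n in number unless the list ends in a gap.
  data Forest : ℕ → Role → Set where
    full : ∀ {ρ} → Forest 0 ρ
    gap  : ∀ {n s} → Forest (suc n) (centre s)
    tree : ∀ {n ρ} (a : Label ρ) → Forest W (next ρ a) → Forest n ρ → Forest (suc n) ρ

  variable
    n s j r : ℕ
    ρ : Role
    π π₀ : List ℕ

  none : ∀ n → Forest n (centre s)
  none zero    = full
  none (suc n) = gap

  verts : Forest n ρ → List ℕ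
  verts full = []
  verts gap = []
  verts {ρ = ρ} (tree a t ts) = vertex ρ a ∷ verts t ++ verts ts

  -- This makes every path from the root a clique, while vertices on different branches need not be
  -- joined.
  Linked : Rel ℕ 0ℓ → List ℕ → Forest n ρ → Set
  Linked J π full = ⊤
  Linked J π gap = ⊤
  Linked {ρ = ρ} J π (tree a t ts) =
    All (J (vertex ρ a)) π × Linked J (vertex ρ a ∷ π) t × Linked J π ts

  Linked-map : ∀ {J J' : Rel ℕ 0ℓ} → (∀ {x y} → J x y → J' x y) →
               (F : Forest n ρ) → Linked J π F → Linked J' π F
  Linked-map f full _ = tt
  Linked-map f gap _ = tt
  Linked-map f (tree a t ts) (l , lt , lts) = All.map f l , Linked-map f t lt , Linked-map f ts lts

  data Grow : Forest n ρ → Forest n ρ → Set where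
    add   : ∀ {a : Label (centre s)} {t} {ts : Forest n (centre s)} → Grow gap (tree a t ts)
    down  : ∀ {a : Label ρ} {t t'} {ts : Forest n ρ} → Grow t t' → Grow (tree a t ts) (tree a t' ts)
    right : ∀ {a : Label ρ} {t} {ts ts' : Forest n ρ} → Grow ts ts' → Grow (tree a t ts) (tree a t ts')

  -- The gap at which π is the path from the root, deepest vertex first, given the path π₀ to the forest itself.
  data Place (s : ℕ) : Forest n ρ → List ℕ → List ℕ → Set where
    here  : Place s (gap {n} {s}) π π
    down  : ∀ {a : Label ρ} {t} {ts : Forest n ρ} → Place s t (vertex ρ a ∷ π₀) π → Place s (tree a t ts) π₀ π
    right : ∀ {a : Label ρ} {t} {ts : Forest n ρ} → Place s ts π₀ π → Place s (tree a t ts) π₀ π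

  insert : ∀ {F : Forest n ρ} → Place s F π₀ π → ∀ j → Forest W (after s j s) → Forest n ρ
  -- Further siblings may still be missing, so the list ends in a gap again unless it has reached
  -- its full length.
  insert (here {n}) j t' = tree j t' (none n)
  insert (down {a = a} {ts = ts} p) j t' = tree a (insert p j t') ts
  insert (right {a = a} {t = t} p) j t' = tree a t (insert p j t')

  insert-grows : ∀ {F : Forest n ρ} (p : Place s F π₀ π) j t → Grow F (insert p j t)
  insert-grows here j t = add
  insert-grows (down p) j t = down (insert-grows p j t)
  insert-grows (right p) j t = right (insert-grows p j t)

  Linked-none : ∀ J π n → Linked J π (none {s} n)
  Linked-none J π zero = tt
  Linked-none J π (suc n) = tt

  Linked-insert : ∀ {J} {F : Forest n ρ} (p : Place s F π₀ π) j t → Linked J π₀ F →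
    All (J (hub (ty s) j)) π → Linked J (hub (ty s) j ∷ π) t → Linked J π₀ (insert p j t)
  Linked-insert (here {n}) j t _ l lt = l , lt , Linked-none _ _ n
  Linked-insert (down p) j t (l₁ , l₂ , l₃) l lt = l₁ , Linked-insert p j t l₂ l lt , l₃
  Linked-insert (right p) j t (l₁ , l₂ , l₃) l lt = l₁ , l₂ , Linked-insert p j t l₃ l lt

  verts-none : ∀ n → verts (none {s} n) ≡ []
  verts-none zero = refl
  verts-none (suc n) = refl

  verts-insert : ∀ {F : Forest n ρ} (p : Place s F π₀ π) j t →
    verts (insert p j t) ↭ (hub (ty s) j ∷ verts t) ++ verts F
  verts-insert (here {n}) j t = ↭-reflexive (cong (λ vs → _ ∷ verts t ++ vs) (verts-none n))
  verts-insert (down {ρ = ρ} {a = a} {t = t₀} {ts = ts} p) j t =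
    trans (prep v (trans (++⁺ʳ (verts ts) (verts-insert p j t))
                         (↭-reflexive (++-assoc new (verts t₀) (verts ts)))))
          (↭-sym (shift v new (verts t₀ ++ verts ts)))
    where v = vertex ρ a
          new = hub _ j ∷ verts t
  verts-insert (right {ρ = ρ} {a = a} {t = t₀} {ts = ts} p) j t =
    trans (prep v (trans (++⁺ˡ (verts t₀) (verts-insert p j t)) (shifts (verts t₀) new)))
          (↭-sym (shift v new (verts t₀ ++ verts ts)))
    where v = vertex ρ a
          new = hub _ j ∷ verts t

  -- Number of leaves in the complete W-ary forest of height r.
  need : ℕ → ℕ
  need zero    = 0
  need (suc r) = W * suc (need r)

  mutual
    -- The block that fills a gap: the leaves are distributed over a complete `W`-ary forest whose
    -- ends are gaps for the next stage.
    build : ∀ r → Vec (Fin j) (need r) → Forest W (after s j r)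
    build zero    _  = none W
    build (suc r) qs = row W r qs

    row : ∀ n r → Vec (Fin j) (n * suc (need r)) → Forest n (leaf s j r)
    row zero    r _        = full
    row (suc n) r (q ∷ qs) = tree q (build r (take (need r) qs)) (row n r (drop (need r) qs))

  rims : ∀ (i : Fin K) {m} → Vec (Fin j) m → List ℕ
  rims i qs = map (rim i) (toList qs)

  rims-take-drop : ∀ i m {n} (qs : Vec (Fin j) (m + n)) → rims i (take m qs) ++ rims i (drop m qs) ≡ rims i qs
  rims-take-drop i m qs = ≡-trans (sym (map-++ _ (toList (take m qs)) _))
    (cong (map (rim i)) (≡-trans (sym (toList-++ (take m qs) (drop m qs))) (cong toList (take++drop≡id m qs))))

  mutual
    verts-build : ∀ r (qs : Vec (Fin j) (need r)) → verts (build {s = s} r qs) ≡ rims (ty s) qs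
    verts-build zero [] = refl
    verts-build (suc r) qs = verts-row W r qs

    verts-row : ∀ n r (qs : Vec (Fin j) (n * suc (need r))) → verts (row {s = s} n r qs) ≡ rims (ty s) qs
    verts-row zero r [] = refl
    verts-row {s = s} (suc n) r (q ∷ qs) = cong (_ ∷_) (≡-trans
      (cong₂ _++_ (verts-build r (take (need r) qs)) (verts-row n r (drop (need r) qs)))
      (rims-take-drop (ty s) (need r) qs))

  module _ {J : Rel ℕ 0ℓ} (J-sym : ∀ {x y} → J x y → J y x) where
    mutual
      -- Leaves that are pairwise joined and all joined to `π` can be arranged in a forest in any
      -- way.
      Linked-build : ∀ r (qs : Vec (Fin j) (need r)) → AllPairs J (rims (ty s) qs) →
        All (λ x → All (J x) π) (rims (ty s) qs) → Linked J π (build {s = s} r qs)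
      Linked-build zero qs _ _ = tt
      Linked-build (suc r) qs = Linked-row W r qs

      Linked-row : ∀ n r (qs : Vec (Fin j) (n * suc (need r))) → AllPairs J (rims (ty s) qs) →
        All (λ x → All (J x) π) (rims (ty s) qs) → Linked J π (row {s = s} n r qs)
      Linked-row zero r [] _ _ = tt
      Linked-row {s = s} (suc n) r (q ∷ qs) (l ∷ ls) (a ∷ as) =
        a ,
        Linked-build r _ (AllPairs-resp-⊆ τ ls)
          (All.zipWith (λ (jx , ax) → J-sym jx ∷ ax) (All-resp-⊆ τ l , All-resp-⊆ τ as)) ,
        Linked-row n r _ (AllPairs-resp-⊆ σ ls) (All-resp-⊆ σ as)
        where
        eq = rims-take-drop (ty s) (need r) qs
        front = rims (ty s) (take (need r) qs)
        back  = rims (ty s) (drop (need r) qs)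
        τ : front ⊆ rims (ty s) qs
        τ = subst (front ⊆_) eq (⊆-++⁺ʳ back (⊆-refl {x = front}))
        σ : back ⊆ rims (ty s) qs
        σ = subst (back ⊆_) eq (⊆-++⁺ˡ front (⊆-refl {x = back}))

  -- Subtrees with four children per node and gaps of one type

  flatten-++ : ∀ ps qs → flatten (ps ++ qs) ≡ flatten ps ++ flatten qs
  flatten-++ [] qs = refl
  flatten-++ ((v , w) ∷ ps) qs = cong (λ vs → v ∷ w ∷ vs) (flatten-++ ps qs)

  data Quad (X : List ℕ → Set) (π : List ℕ) : Set where
    stop : X π → Quad X π
    quad : ∀ v₁ v₂ v₃ v₄ → Quad X (v₁ ∷ π) → Quad X (v₂ ∷ π) → Quad X (v₃ ∷ π) → Quad X (v₄ ∷ π) → Quad X π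

  -- Winning a vertex of each pair secures two of the four children at every node.
  quadPairs : ∀ {X} → Quad X π → List (ℕ × ℕ)
  quadPairs (stop x) = []
  quadPairs (quad v₁ v₂ v₃ v₄ t₁ t₂ t₃ t₄) = (v₁ , v₂) ∷ (v₃ , v₄) ∷
    (quadPairs t₁ ++ quadPairs t₂) ++ (quadPairs t₃ ++ quadPairs t₄)

  quadVerts : ∀ {X} → Quad X π → List ℕ
  quadVerts = flatten ∘ quadPairs

  quadVerts-quad : ∀ {X v₁ v₂ v₃ v₄} (t₁ : Quad X (v₁ ∷ π)) (t₂ : Quad X (v₂ ∷ π)) (t₃ : Quad X (v₃ ∷ π))
    (t₄ : Quad X (v₄ ∷ π)) → quadVerts (quad v₁ v₂ v₃ v₄ t₁ t₂ t₃ t₄) ≡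
    v₁ ∷ v₂ ∷ v₃ ∷ v₄ ∷ (quadVerts t₁ ++ quadVerts t₂) ++ (quadVerts t₃ ++ quadVerts t₄)
  quadVerts-quad t₁ t₂ t₃ t₄ = cong (λ vs → _ ∷ _ ∷ _ ∷ _ ∷ vs)
    (≡-trans (flatten-++ (quadPairs t₁ ++ quadPairs t₂) _)
             (cong₂ _++_ (flatten-++ (quadPairs t₁) _) (flatten-++ (quadPairs t₃) _)))

  -- The vertices level by level below the root: the order in which a Quad lists its vertices.
  roots : Forest n ρ → List ℕ
  roots full = []
  roots gap = []
  roots {ρ = ρ} (tree a _ ts) = vertex ρ a ∷ roots ts

  deep : Forest n ρ → List ℕ
  deep full = []
  deep gap = []
  deep (tree _ t ts) = (roots t ++ deep t) ++ deep ts

  verts↭roots++deep : (F : Forest n ρ) → verts F ↭ roots F ++ deep F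
  verts↭roots++deep full = ↭-refl
  verts↭roots++deep gap = ↭-refl
  verts↭roots++deep (tree a t ts) = prep _ (trans
    (↭-++⁺ (verts↭roots++deep t) (verts↭roots++deep ts))
    (shifts (roots t ++ deep t) (roots ts)))

  module _ (F₀ : Forest W (centre 0)) where

    Spot : Fin K → List ℕ → Set
    Spot i π = Σ[ s ∈ ℕ ] ty s ≡ i × Place s F₀ [] π

    Candidate : List ℕ → Set
    Candidate π = Σ[ i ∈ Fin K ] Σ[ v ∈ ℕ ] Quad (Spot i) (v ∷ π)

    top : Candidate π → ℕ
    top (_ , v , _) = v

    below : Candidate π → List ℕ
    below (_ , _ , t) = quadVerts t

    concatMap-⊆ : {xs ys : List (Candidate π)} → xs ⊆ ys → concatMap below xs ⊆ concatMap below ys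
    concatMap-⊆ [] = []
    concatMap-⊆ (y ∷ʳ τ) = ⊆-++⁺ˡ (below y) (concatMap-⊆ τ)
    concatMap-⊆ {xs = x ∷ _} (refl ∷ τ) = ⊆-++⁺ (⊆-refl {x = below x}) (concatMap-⊆ τ)

    mutual
      -- A gap among the children can itself end the subtree; otherwise each child yields a
      -- candidate with the type found below it. `emb` turns gaps of the subforest into gaps of
      -- `F₀`.
      collect : (F : Forest n ρ) (π : List ℕ) → (∀ {s π'} → Place s F π π' → Place s F₀ [] π') →
        (∃[ i ] Spot i π) ⊎
        (Σ[ cs ∈ List (Candidate π) ] length cs ≡ n × map top cs ≡ roots F × concatMap below cs ⊆ deep F)
      collect full π emb = inj₂ ([] , refl , refl , [])
      collect gap π emb = inj₁ (_ , _ , refl , emb here)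
      collect {ρ = ρ} (tree a t ts) π emb with collect ts π (emb ∘ right)
      ... | inj₁ found = inj₁ found
      ... | inj₂ (cs , len , tops , belows) =
        let (i , t' , τ) = thick t (vertex ρ a ∷ π) (emb ∘ down) in
        inj₂ ((i , _ , t') ∷ cs , cong suc len , cong (_ ∷_) tops , ⊆-++⁺ τ belows)

      thick : (F : Forest W ρ) (π : List ℕ) → (∀ {s π'} → Place s F π π' → Place s F₀ [] π') →
        Σ[ i ∈ Fin K ] Σ[ t ∈ Quad (Spot i) π ] quadVerts t ⊆ roots F ++ deep F
      thick F π emb with collect F π emb
      ... | inj₁ (i , spot) = i , stop spot , minimum _
      ... | inj₂ (cs , len , tops , belows)
        with (i , v₁ , t₁) , (_ , v₂ , t₂) , (_ , v₃ , t₃) , (_ , v₄ , t₄) , τ , e₂ , e₃ , e₄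
               ← alike₄ K (toℕ ∘ proj₁) cs (All.universal (Fin.toℕ<n ∘ proj₁) cs)
                        -- A list without a gap has `W` candidates, one more than `3 * K`.
                        (subst (3 * K <_) (sym len) ≤-refl)
        with refl ← Fin.toℕ-injective e₂ | refl ← Fin.toℕ-injective e₃ | refl ← Fin.toℕ-injective e₄ =
        i , quad v₁ v₂ v₃ v₄ t₁ t₂ t₃ t₄ ,
        subst (_⊆ roots F ++ deep F) (sym (quadVerts-quad t₁ t₂ t₃ t₄))
          (⊆-++⁺ (subst (_ ⊆_) tops (map⁺ top τ))
                 (⊆-trans (subst (_⊆ concatMap below cs) regroup (concatMap-⊆ τ)) belows))
        where
        q₁ = quadVerts t₁ ; q₂ = quadVerts t₂ ; q₃ = quadVerts t₃ ; q₄ = quadVerts t₄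
        regroup : q₁ ++ q₂ ++ q₃ ++ q₄ ++ [] ≡ (q₁ ++ q₂) ++ (q₃ ++ q₄)
        regroup rewrite ++-identityʳ q₄ = sym (++-assoc q₁ q₂ (q₃ ++ q₄))

  -- Binary trees that take in new vertices

  data Bin (X : ℕ → List ℕ → Set) (π : List ℕ) : Set where
    stop : ∀ {r} → X r π → Bin X π
    one  : ∀ {r} → X (suc r) π → ∀ v → Bin X (v ∷ π) → Bin X π
    two  : ∀ v w → Bin X (v ∷ π) → Bin X (w ∷ π) → Bin X π

  variable
    X Y : ℕ → List ℕ → Set

  binVerts : Bin X π → List ℕ
  binVerts (stop _) = []
  binVerts (one _ v t) = v ∷ binVerts t
  binVerts (two v w t u) = v ∷ w ∷ binVerts t ++ binVerts u

  -- A vertex to be inserted halts at a node with a single child, so only these pairs matter to it.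
  binPairs : Bin X π → List (ℕ × ℕ)
  binPairs (stop _) = []
  binPairs (one _ _ _) = []
  binPairs (two v w t u) = (v , w) ∷ binPairs t ++ binPairs u

  binPairs⊆binVerts : (t : Bin X π) → flatten (binPairs t) ⊆ binVerts t
  binPairs⊆binVerts (stop _) = []
  binPairs⊆binVerts (one _ v t) = minimum _
  binPairs⊆binVerts (two v w t u) = refl ∷ refl ∷
    subst (_⊆ binVerts t ++ binVerts u) (sym (flatten-++ (binPairs t) (binPairs u)))
      (⊆-++⁺ (binPairs⊆binVerts t) (binPairs⊆binVerts u))

  -- The number of vertices of a complete binary forest of height r.
  room : ℕ → ℕ
  room zero    = 0
  room (suc r) = suc (suc (room r + room r))

  capacity : Bin X π → ℕ
  capacity (stop {r} _) = room r
  capacity (one {r} _ _ t) = suc (capacity t + room r)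
  capacity (two _ _ t u) = capacity t + capacity u

  binMap : (∀ {r π} → X r π → Y r π) → Bin X π → Bin Y π
  binMap f (stop x) = stop (f x)
  binMap f (one x v t) = one (f x) v (binMap f t)
  binMap f (two v w t u) = two v w (binMap f t) (binMap f u)

  binVerts-map : (f : ∀ {r π} → X r π → Y r π) (t : Bin X π) → binVerts (binMap {Y = Y} f t) ≡ binVerts t
  binVerts-map f (stop x) = refl
  binVerts-map f (one x v t) = cong (v ∷_) (binVerts-map f t)
  binVerts-map f (two v w t u) = cong₂ (λ xs ys → v ∷ w ∷ xs ++ ys) (binVerts-map f t) (binVerts-map f u)

  binPairs-map : (f : ∀ {r π} → X r π → Y r π) (t : Bin X π) → binPairs (binMap {Y = Y} f t) ≡ binPairs t
  binPairs-map f (stop x) = refl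
  binPairs-map f (one x v t) = refl
  binPairs-map f (two v w t u) = cong₂ (λ xs ys → (v , w) ∷ xs ++ ys) (binPairs-map f t) (binPairs-map f u)

  capacity-map : (f : ∀ {r π} → X r π → Y r π) (t : Bin X π) → capacity (binMap {Y = Y} f t) ≡ capacity t
  capacity-map f (stop x) = refl
  capacity-map f (one {r} x v t) = cong (λ c → suc (c + room r)) (capacity-map f t)
  capacity-map f (two v w t u) = cong₂ _+_ (capacity-map f t) (capacity-map f u)

  -- At a node with two children, `l` follows a child that it is joined to; elsewhere it becomes a
  -- new child. Either a path with nothing missing is met, or the capacity drops by exactly one, so
  -- this cannot go on for ever.
  binInsert : ∀ {l} {J : ℕ → Set} → (∀ {r π} → X (suc r) π → All J π → X r (l ∷ π)) →
    (t : Bin X π) → All (Either J) (binPairs t) → All J π →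
    (∃[ π' ] X 0 π') ⊎ (Σ[ t' ∈ Bin X π ] suc (capacity t') ≡ capacity t × binVerts t' ↭ l ∷ binVerts t)
  binInsert ext (stop {zero} x) _ _ = inj₁ (_ , x)
  binInsert ext (stop {suc r} x) _ js = inj₂ (one x _ (stop (ext x js)) , refl , ↭-refl)
  -- As a sibling of `v`, the new vertex need not be joined to `v`.
  binInsert {l = l} ext (one x v t) _ js =
    inj₂ (two v l t (stop (ext x js)) , refl , swap v l (↭-reflexive (++-identityʳ (binVerts t))))
  binInsert {l = l} ext (two v w t u) (p ∷ ps) js with All.++⁻ (binPairs t) ps
  binInsert {l = l} ext (two v w t u) (inj₁ jv ∷ ps) js | pt , pu with binInsert ext t pt (jv ∷ js)
  ... | inj₁ found = inj₁ found
  ... | inj₂ (t' , cap , perm) = inj₂ (two v w t' u , cong (_+ capacity u) cap ,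
    trans (prep v (prep w (++⁺ʳ (binVerts u) perm))) (shifts (v ∷ w ∷ []) (l ∷ [])))
  binInsert {l = l} ext (two v w t u) (inj₂ jw ∷ ps) js | pt , pu with binInsert ext u pu (jw ∷ js)
  ... | inj₁ found = inj₁ found
  ... | inj₂ (u' , cap , perm) = inj₂ (two v w t u' ,
    ≡-trans (sym (+-suc (capacity t) (capacity u'))) (cong (capacity t +_) cap) ,
    trans (prep v (prep w (trans (++⁺ˡ (binVerts t) perm) (shift l (binVerts t) (binVerts u)))))
          (shifts (v ∷ w ∷ []) (l ∷ [])))

  -- Tower r π: the path π consists of a path to a gap, followed by leaves of the star, of which r are still missing.
  data Tower (F : Forest W (centre 0)) (i : Fin K) (j : ℕ) (J : Rel ℕ 0ℓ) : ℕ → List ℕ → Set where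
    base : ∀ {s π} → ty s ≡ i → Place s F [] π → All (J (hub i j)) π → Tower F i j J (need s) π
    grow : ∀ {r π} (q : Fin j) → rim i q ∉ verts F → J (rim i q) (hub i j) → All (J (rim i q)) π →
           Tower F i j J (suc r) π → Tower F i j J r (rim i q ∷ π)

  variable
    F : Forest W (centre 0)
    i : Fin K
    J J' : Rel ℕ 0ℓ

  towerMap : (∀ {x y} → J x y → J' x y) → Tower F i j J r π → Tower F i j J' r π
  towerMap f (base eq p js) = base eq p (All.map f js)
  towerMap f (grow q q∉ jc js t) = grow q q∉ (f jc) (All.map f js) (towerMap f t)

  -- Bounds the capacity of whichever binary subtree the pairing will leave, so the size of the new
  -- component can be chosen before it is known which pairs Maker wins.
  reserve : Quad (Spot F i) π → ℕ
  reserve (stop (s , _)) = room (need s)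
  reserve (quad _ _ _ _ t₁ t₂ t₃ t₄) = (reserve t₁ + reserve t₂) + (reserve t₃ + reserve t₄)

  module Select (F : Forest W (centre 0)) (i : Fin K) (j : ℕ) (J : Rel ℕ 0ℓ) where

    Selection : List ℕ → ℕ → List ℕ → Set
    Selection π c vs = Σ[ t ∈ Bin (Tower F i j J) π ] capacity t ≤ c × binVerts t ⊆ vs

    mutual
      select : (t : Quad (Spot F i) π) → All (Either (J (hub i j))) (quadPairs t) → All (J (hub i j)) π →
               Selection π (reserve t) (quadVerts t)
      select (stop (s , eq , p)) _ js = stop (base eq p js) , ≤-refl , []
      select (quad v₁ v₂ v₃ v₄ t₁ t₂ t₃ t₄) (p ∷ p' ∷ ps) js =
        let (ps₁₂ , ps₃₄) = All.++⁻ (quadPairs t₁ ++ quadPairs t₂) ps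
            (v , t , v⊆ , t≤ , t⊆) = choose t₁ t₂ p ps₁₂ js
            (w , u , w⊆ , u≤ , u⊆) = choose t₃ t₄ p' ps₃₄ js
        in two v w t u , +-mono-≤ t≤ u≤ ,
           subst (binVerts (two v w t u) ⊆_) (sym (quadVerts-quad t₁ t₂ t₃ t₄))
             (⊆-++⁺ (⊆-++⁺ v⊆ w⊆) (⊆-++⁺ t⊆ u⊆))

      choose : ∀ {v w} (t : Quad (Spot F i) (v ∷ π)) (u : Quad (Spot F i) (w ∷ π)) → Either (J (hub i j)) (v , w) →
               All (Either (J (hub i j))) (quadPairs t ++ quadPairs u) → All (J (hub i j)) π →
               Σ[ x ∈ ℕ ] Σ[ b ∈ Bin (Tower F i j J) (x ∷ π) ]
                 (x ∷ []) ⊆ (v ∷ w ∷ []) × capacity b ≤ reserve t + reserve u × binVerts b ⊆ quadVerts t ++ quadVerts u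
      choose {v = v} {w} t u (inj₁ jv) ps js =
        let (b , b≤ , b⊆) = select t (All.++⁻ˡ (quadPairs t) ps) (jv ∷ js) in
        v , b , refl ∷ w ∷ʳ [] , ≤-trans b≤ (m≤m+n _ _) , ⊆-++⁺ʳ (quadVerts u) b⊆
      choose {v = v} {w} t u (inj₂ jw) ps js =
        let (b , b≤ , b⊆) = select u (All.++⁻ʳ (quadPairs t) ps) (jw ∷ js) in
        w , b , v ∷ʳ refl ∷ [] , ≤-trans b≤ (m≤n+m _ _) , ⊆-++⁺ˡ (quadVerts t) b⊆

  -- Joining leaves of the new component one at a time

  rim≢hub : ∀ {j j'} (q : Fin j) → rim i q ≢ hub i j'
  rim≢hub {i} q eq with () ← g-injective i eq

  rim-injective : ∀ {j} {q q' : Fin j} → rim i q ≡ rim i q' → q ≡ q'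
  rim-injective {i} eq with refl ← g-injective i eq = refl

  -- An upper bound on the vertices in the way of the last of n + 1 insertions into a Bin with at most b vertices,
  -- in a position with at most a rounds and with f further forbidden vertices.
  budget : (f n a b : ℕ) → ℕ
  budget f zero    a b = suc (4 * a + (f + b))
  budget f (suc n) a b = suc (4 * a + (f + b)) + budget f n (suc b + a) (suc b)

  budget-now : ∀ f n a b → suc (4 * a + (f + b)) ≤ budget f n a b
  budget-now f zero a b = ≤-refl
  budget-now f (suc n) a b = m≤m+n _ _

  few-obstacles : ∀ {a b} P xs ys → length P ≤ a → length ys ≤ b →
                  length (touched P ++ xs ++ ys) < suc (4 * a + (length xs + b))
  few-obstacles {a} {b} P xs ys P≤a ys≤b = s≤s (begin
    length (touched P ++ xs ++ ys)                 ≡⟨ length-++ (touched P) ⟩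
    length (touched P) + length (xs ++ ys)         ≡⟨ cong₂ _+_ (length-touched P) (length-++ xs) ⟩
    4 * length P + (length xs + length ys)         ≤⟨ +-mono-≤ (*-monoʳ-≤ 4 P≤a) (+-monoʳ-≤ (length xs) ys≤b) ⟩
    4 * a + (length xs + b)                        ∎)
    where open ≤-Reasoning

  -- An untouched leaf is joined to the hub and to a vertex of each pair, then inserted. As the
  -- capacity falls each time, some path is complete after at most n + 1 insertions; `budget`
  -- guarantees a usable leaf for each.
  climb : ∀ n a b {P} (t : Bin (Tower F i j (Joined P)) []) → capacity t ≤ n → length P ≤ a →
    length (binVerts t) ≤ b → Unique (binVerts t) → hub i j ∉ binVerts t → budget (length (verts F)) n a b ≤ j →
    Force (λ P' → P ⊆ P' × ∃[ π ] Tower F i j (Joined P') 0 π) P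
  climb {F} {i} {j} n a b {P} t cap≤n P≤a t≤b t-unique hub∉t big
    with q , rim∉ ← avoid _≟_ (rim i {j}) rim-injective (touched P ++ verts F ++ binVerts t)
                      (<-≤-trans (few-obstacles P (verts F) (binVerts t) P≤a t≤b)
                                 (≤-trans (budget-now (length (verts F)) n a b) big)) =
    bind (claim-pairs-and (rim i q) (hub i j) (binPairs t) (rim∉ ∘ ∈-++⁺ˡ)
           (λ { (here eq) → rim≢hub q eq ; (there v∈) → rim∉t (Any-resp-⊆ pairs⊆ v∈) })
           (∉⇒All≢ (hub∉t ∘ Any-resp-⊆ pairs⊆) ∷ AllPairs-resp-⊆ pairs⊆ t-unique))
    λ {P'} (sub , len , jc , won) →
      continue n cap≤n big sub len
        (Sum.map₂ (λ (t' , cap , perm) → t' , ≡-trans cap (capacity-map (lift sub) t) ,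
                     subst (λ vs → binVerts t' ↭ l ∷ vs) (binVerts-map (lift sub) t) perm)
          (binInsert (λ x js → grow q rim∉F jc js x) (binMap (lift sub) t)
            (subst (All _) (sym (binPairs-map (lift sub) t)) won) []))
    where
    l = rim i q
    pairs⊆ = binPairs⊆binVerts t
    lift : ∀ {P' r π} → P ⊆ P' → Tower F i j (Joined P) r π → Tower F i j (Joined P') r π
    lift sub = towerMap (Any-resp-⊆ sub)
    rim∉F : l ∉ verts F
    rim∉F = rim∉ ∘ ∈-++⁺ʳ (touched P) ∘ ∈-++⁺ˡ
    rim∉t : l ∉ binVerts t
    rim∉t = rim∉ ∘ ∈-++⁺ʳ (touched P) ∘ ∈-++⁺ʳ (verts F)
    hub∉l∷t : hub i j ∉ l ∷ binVerts t
    hub∉l∷t (here eq) = rim≢hub q (sym eq)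
    hub∉l∷t (there hub∈) = hub∉t hub∈

    continue : ∀ n {P'} → capacity t ≤ n → budget (length (verts F)) n a b ≤ j →
      P ⊆ P' → length P' ≤ suc (length (flatten (binPairs t))) + length P →
      (∃[ π ] Tower F i j (Joined P') 0 π) ⊎
      (Σ[ t' ∈ Bin (Tower F i j (Joined P')) [] ] suc (capacity t') ≡ capacity t × binVerts t' ↭ l ∷ binVerts t) →
      Force (λ P' → P ⊆ P' × ∃[ π ] Tower F i j (Joined P') 0 π) P'
    continue _ _ _ sub _ (inj₁ tower) = done (sub , tower)
    -- With capacity 0 an insertion can only meet a complete path.
    continue zero cap≤n _ _ _ (inj₂ (_ , cap , _)) = contradiction (≤-trans (≤-reflexive cap) cap≤n) λ ()
    continue (suc n) cap≤n big sub len (inj₂ (t' , cap , perm)) =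
      bind (climb n (suc b + a) (suc b) t' (≤-pred (≤-trans (≤-reflexive cap) cap≤n))
        -- The insertion has cost at most one round for the hub and one for each of the at most `b`
        -- paired vertices.
        (≤-trans len (+-mono-≤ (s≤s (≤-trans (length-mono-≤ pairs⊆) t≤b)) P≤a))
        (≤-trans (≤-reflexive (↭-length perm)) (s≤s t≤b))
        (Unique-resp-↭ (↭-sym perm) (∉⇒All≢ rim∉t ∷ t-unique))
        (hub∉l∷t ∘ ∈-resp-↭ perm)
        (≤-trans (m≤n+m _ _) big))
      λ (sub' , tower) → done (⊆-trans sub sub' , tower)

  -- Filling a gap and completing a round

  record Harvest (F : Forest W (centre 0)) (i : Fin K) (j : ℕ) (J : Rel ℕ 0ℓ) (r : ℕ) (π : List ℕ) : Set where
    field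
      {stage m}  : ℕ
      {path}     : List ℕ
      leaves     : Vec (Fin j) m
      type       : ty stage ≡ i
      place      : Place stage F [] path
      enough     : r + m ≡ need stage
      hub-path   : All (J (hub i j)) path
      split      : π ≡ rims i leaves ++ path
      leaf-leaf  : AllPairs J (rims i leaves)
      leaf-path  : All (λ x → All (J x) path) (rims i leaves)
      leaf-hub   : All (λ x → J x (hub i j)) (rims i leaves)
      outside    : All (_∉ verts F) (rims i leaves)

  harvest : Tower F i j J r π → Harvest F i j J r π
  harvest (base eq p js) = record
    { leaves = [] ; type = eq ; place = p ; enough = +-identityʳ _ ; hub-path = js ; split = refl
    ; leaf-leaf = [] ; leaf-path = [] ; leaf-hub = [] ; outside = [] }
  harvest {i = i} {r = r} (grow q q∉ jc js t) with harvest t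
  ... | record { leaves = qs ; type = eq ; place = p ; enough = enough ; hub-path = hp ; split = refl
               ; leaf-leaf = mut ; leaf-path = lp ; leaf-hub = lh ; outside = out } = record
    { leaves = q ∷ qs ; type = eq ; place = p ; enough = ≡-trans (+-suc r _) enough ; hub-path = hp ; split = refl
    ; leaf-leaf = All.++⁻ˡ (rims i qs) js ∷ mut ; leaf-path = All.++⁻ʳ (rims i qs) js ∷ lp
    ; leaf-hub = jc ∷ lh ; outside = q∉ ∷ out }

  State : Position → Set
  State P = Σ[ F ∈ Forest W (centre 0) ] Linked (Joined P) [] F × Unique (verts F)

  Grown : ∀ {P P'} → State P → State P' → Set
  Grown (F , _) (F' , _) = Grow F F'

  -- A complete tower holds exactly `need s` leaves, which are rearranged into the `W`-ary block of
  -- stage `s` below the hub.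
  attach : ∀ {P π} → Linked (Joined P) [] F → Unique (verts F) → hub i j ∉ verts F → Tower F i j (Joined P) 0 π →
           Σ[ s ∈ State P ] Grow F (proj₁ s)
  attach {F} {i} {j} {P} linked unique hub∉ tower with harvest tower
  ... | record { stage = s ; leaves = qs ; type = refl ; place = p ; enough = refl ; hub-path = hp
               ; leaf-leaf = mut ; leaf-path = lp ; leaf-hub = lh ; outside = out } =
    (insert p j block ,
     Linked-insert p j block linked hp
       (Linked-build (Joined-sym {P}) s qs mut (All.zipWith (λ (h , ls) → h ∷ ls) (lh , lp))) ,
     Unique-resp-↭ (↭-sym (verts-insert p j block)) (AllPairs.++⁺ block-unique unique block∉)) ,
    insert-grows p j block
    where
    block = build {s = s} s qs
    block-verts : verts block ≡ rims (ty s) qs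
    block-verts = verts-build s qs
    -- Joined vertices are distinct, so the block has no repetitions.
    block-unique : Unique (hub i j ∷ verts block)
    block-unique = subst (λ vs → Unique (_ ∷ vs)) (sym block-verts) (
      All.map (λ jl eq → Joined-irrefl {P} jl (sym eq)) lh ∷ AllPairs.map (Joined-irrefl {P}) mut)
    block∉ : All (λ x → All (x ≢_) (verts F)) (hub i j ∷ verts block)
    block∉ = ∉⇒All≢ hub∉ ∷ subst (All _) (sym block-verts) (All.map ∉⇒All≢ out)

  enough-leaves : Position → (F : Forest W (centre 0)) → Quad (Spot F i) [] → ℕ
  enough-leaves P F t =
    budget (length (verts F)) (reserve t) (length (quadVerts t) + length P) (length (quadVerts t))

  play-round : ∀ {P} (s : State P) → Force (λ P' → Σ (State P') (Grown s)) P
  play-round {P} (F , linked , unique)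
    with i , t , t⊆ ← thick F F [] id
    -- Only components with enough leaves are considered; among sufficiently many of them, one has a
    -- new hub.
    with m , hub∉ ← avoid _≟_ {suc (length (touched P ++ verts F))}
           (λ m → hub i (enough-leaves P F t + toℕ m))
           (λ eq → Fin.toℕ-injective (+-cancelˡ-≡ _ _ _ (cong proj₁ (g-injective i eq))))
           (touched P ++ verts F) ≤-refl =
    bind (claim-pairs (hub i size) (quadPairs t) (hub∉ ∘ ∈-++⁺ˡ) (hub∉F ∘ quad⊆F) t-unique)
    λ {P'} (sub , len , won) →
      let (bin , room≤ , bin⊆) = Select.select F i size (Joined P') t won [] in
      bind (climb (reserve t) _ _ bin room≤ len (length-mono-≤ bin⊆) (AllPairs-resp-⊆ bin⊆ t-unique)
             (hub∉F ∘ quad⊆F ∘ Any-resp-⊆ bin⊆) (m≤m+n _ (toℕ m)))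
      λ (sub' , _ , tower) →
        done (attach (Linked-map (Any-resp-⊆ (⊆-trans sub sub')) F linked) unique hub∉F tower)
    where
    size = enough-leaves P F t + toℕ m
    hub∉F : hub i size ∉ verts F
    hub∉F = hub∉ ∘ ∈-++⁺ʳ (touched P)
    t-unique : Unique (quadVerts t)
    t-unique = AllPairs-resp-⊆ t⊆ (Unique-resp-↭ (verts↭roots++deep F) unique)
    quad⊆F : ∀ {v} → v ∈ quadVerts t → v ∈ verts F
    quad⊆F = ∈-resp-↭ (↭-sym (verts↭roots++deep F)) ∘ Any-resp-⊆ t⊆

  initial : State []
  initial = gap , tt , []

  -- The first move of a round is wasted, so that every round does contain a move.
  round : ∀ {P} (s : State P) → Σ[ m ∈ Edge ] m ∉ moves P ×
          (∀ b → b ∉ m ∷ moves P → Force (λ P' → Σ (State P') (Grown s)) ((m , b) ∷ P))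
  round {P} (F , linked , unique) = let (m , m∉) = fresh-edge (moves P) in
    m , m∉ , λ b _ → play-round (F , Linked-map there F linked , unique)

  -- König's lemma

  module Limit (em : ExcludedMiddle 0ℓ) (J : Rel ℕ 0ℓ) (J-sym : ∀ {x y} → J x y → J y x) where

    Often : (ℕ → Set) → Set
    Often P = ∀ t → ∃[ t' ] t ≤ t' × P t'

    -- If `Q` fails from some time on, every later occurrence of `P` is one of `R`; excluded middle
    -- decides whether there is such a time.
    often-⊎ : ∀ {P Q R : ℕ → Set} → (∀ t → P t → Q t ⊎ R t) → Often P → Often Q ⊎ Often R
    often-⊎ {P} {Q} {R} split often with em {∃[ t ] (∀ t' → t ≤ t' → ¬ Q t')}
    ... | yes (t₀ , never) = inj₂ λ t →
      let (t' , t≤t' , pt') = often (t₀ + t) in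
      t' , ≤-trans (m≤n+m t t₀) t≤t' ,
      Sum.[ (λ q → contradiction q (never t' (≤-trans (m≤m+n t₀ t) t≤t'))) , id ]′ (split t' pt')
    ... | no ¬never = inj₁ λ t → search t em
      where
      search : ∀ t → Dec (∃[ t' ] t ≤ t' × Q t') → ∃[ t' ] t ≤ t' × Q t'
      search t (yes found) = found
      search t (no none) = contradiction (t , λ t' t≤t' q → none (t' , t≤t' , q)) ¬never

    Steps : (ℕ → Forest n ρ) → Set
    Steps f = ∀ t → f t ≡ f (suc t) ⊎ Grow (f t) (f (suc t))

    -- Equal consecutive forests are allowed, because a growth elsewhere in the tree leaves a
    -- subforest unchanged.
    record Chain (n : ℕ) (ρ : Role) (π : List ℕ) : Set where
      field
        forest : ℕ → Forest n ρ
        linked : ∀ t → Linked J π (forest t)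
        steps  : Steps forest
        often  : Often (λ t → Grow (forest t) (forest (suc t)))

    grown : ∀ {F F' : Forest n ρ} → Grow F F' →
            ∃[ m ] Σ[ eq ∈ n ≡ suc m ] ∃[ a ] ∃[ t ] ∃[ ts ] subst (λ n → Forest n ρ) eq F' ≡ tree a t ts
    grown add = _ , refl , _ , _ , _ , refl
    grown (down _) = _ , refl , _ , _ , _ , refl
    grown (right _) = _ , refl , _ , _ , _ , refl

    persists : ∀ {a : Label ρ} {t} {ts : Forest n ρ} {F} →
               tree a t ts ≡ F ⊎ Grow (tree a t ts) F → ∃[ t' ] ∃[ ts' ] F ≡ tree a t' ts'
    persists (inj₁ refl) = _ , _ , refl
    persists (inj₂ (down _)) = _ , _ , refl
    persists (inj₂ (right _)) = _ , _ , refl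

    tree-grows : ∀ {a : Label ρ} {t t'} {ts ts' : Forest n ρ} → Grow (tree a t ts) (tree a t' ts') →
                 (Grow t t' × ts ≡ ts') ⊎ (t ≡ t' × Grow ts ts')
    tree-grows (down g) = inj₁ (g , refl)
    tree-grows (right g) = inj₂ (refl , g)

    tree-injective : ∀ {a : Label ρ} {t t'} {ts ts' : Forest n ρ} → tree a t ts ≡ tree a t' ts' → t ≡ t' × ts ≡ ts'
    tree-injective refl = refl , refl

    -- Growth hits the forest below the first child infinitely often or the remaining siblings
    -- infinitely often; in the latter case one child fewer remains to be searched.
    branch : ∀ n → Chain n ρ π → Σ[ a ∈ Label ρ ] All (J (vertex ρ a)) π × Chain W (next ρ a) (vertex ρ a ∷ π)
    branch {ρ} {π} n C with t₀ , _ , g₀ ← Chain.often C 0 with grown g₀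
    ... | m , refl , a , t₁ , ts₁ , eq₁ = go (often-⊎ splits often)
      where
      open Chain C using (forest; linked; steps)
      -- After its first growth the forest has a first child, whose label then never changes; the
      -- sequence is shifted to begin there.
      f : ℕ → Forest (suc m) ρ
      f t = forest (t + suc t₀)
      shape : ∀ t → ∃[ u ] ∃[ us ] f t ≡ tree a u us
      shape zero = t₁ , ts₁ , eq₁
      shape (suc t) = let (u , us , eq) = shape t in
        persists (Sum.map (≡-trans (sym eq)) (subst (λ F → Grow F (f (suc t))) eq) (steps (t + suc t₀)))
      child : ℕ → Forest W (next ρ a)
      child t = proj₁ (shape t)
      siblings : ℕ → Forest m ρ
      siblings t = proj₁ (proj₂ (shape t))
      shape≡ : ∀ t → f t ≡ tree a (child t) (siblings t)
      shape≡ t = proj₂ (proj₂ (shape t))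
      linked-tree : ∀ t → Linked J π (tree a (child t) (siblings t))
      linked-tree t = subst (Linked J π) (shape≡ t) (linked (t + suc t₀))
      grow-tree : ∀ t → Grow (f t) (f (suc t)) → (Grow (child t) (child (suc t)) × siblings t ≡ siblings (suc t)) ⊎
                                                 (child t ≡ child (suc t) × Grow (siblings t) (siblings (suc t)))
      grow-tree t g = tree-grows (subst₂ Grow (shape≡ t) (shape≡ (suc t)) g)
      keep-tree : ∀ t → f t ≡ f (suc t) → child t ≡ child (suc t) × siblings t ≡ siblings (suc t)
      keep-tree t eq = tree-injective (≡-trans (sym (shape≡ t)) (≡-trans eq (shape≡ (suc t))))
      child-steps : Steps child
      child-steps t = Sum.[ inj₁ ∘ proj₁ ∘ keep-tree t , Sum.swap ∘ Sum.map proj₁ proj₁ ∘ grow-tree t ]′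
                        (steps (t + suc t₀))
      sibling-steps : Steps siblings
      sibling-steps t = Sum.[ inj₁ ∘ proj₂ ∘ keep-tree t , Sum.map proj₂ proj₂ ∘ grow-tree t ]′
                          (steps (t + suc t₀))
      splits : ∀ t → Grow (f t) (f (suc t)) → Grow (child t) (child (suc t)) ⊎ Grow (siblings t) (siblings (suc t))
      splits t g = Sum.map proj₁ proj₂ (grow-tree t g)
      often : Often (λ t → Grow (f t) (f (suc t)))
      often t with t' , t≤t' , g ← Chain.often C (t + suc t₀)
        with k , refl ← m≤n⇒∃[o]m+o≡n t≤t' =
        t + k , m≤m+n t k , subst (λ t → Grow (forest t) (forest (suc t))) rearrange g
        where
        rearrange : t + suc t₀ + k ≡ t + k + suc t₀
        rearrange = ≡-trans (+-assoc t _ k) (≡-trans (cong (t +_) (+-comm (suc t₀) k)) (sym (+-assoc t k _)))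
      go : Often (λ t → Grow (child t) (child (suc t))) ⊎ Often (λ t → Grow (siblings t) (siblings (suc t))) →
           Σ[ a ∈ Label ρ ] All (J (vertex ρ a)) π × Chain W (next ρ a) (vertex ρ a ∷ π)
      go (inj₁ o) = a , proj₁ (linked-tree 0) , record
        { forest = child ; linked = proj₁ ∘ proj₂ ∘ linked-tree ; steps = child-steps ; often = o }
      go (inj₂ o) = branch m record
        { forest = siblings ; linked = proj₂ ∘ proj₂ ∘ linked-tree ; steps = sibling-steps ; often = o }

    record Leaves (s j r : ℕ) (π : List ℕ) : Set where
      field
        pick        : Fin r → Fin j
        {path}      : List ℕ
        chain       : Chain W (centre (suc s)) path
        joined-path : ∀ q → All (J (rim (ty s) (pick q))) π
        joined      : ∀ {q q'} → q ≢ q' → J (rim (ty s) (pick q)) (rim (ty s) (pick q'))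
        extends     : ∀ {x} → x ∈ π → x ∈ path
        pick∈path   : ∀ q → rim (ty s) (pick q) ∈ path

    leaves : ∀ r → Chain W (after s j r) π → Leaves s j r π
    leaves zero C = record
      { pick = λ () ; chain = C ; joined-path = λ () ; joined = λ { {()} } ; extends = id ; pick∈path = λ () }
    leaves {s} {j} (suc r) C with q₀ , linked₀ , C' ← branch W C = record
      { pick = pick
      ; chain = Leaves.chain rest
      ; joined-path = λ { zero → linked₀ ; (suc q) → All.tail (Leaves.joined-path rest q) }
      ; joined = joined
      ; extends = Leaves.extends rest ∘ there
      ; pick∈path = λ { zero → Leaves.extends rest (here refl) ; (suc q) → Leaves.pick∈path rest q } }
      where
      rest = leaves r C'
      pick : Fin (suc r) → Fin j
      pick zero    = q₀
      pick (suc q) = Leaves.pick rest q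
      joined : ∀ {q q'} → q ≢ q' → J (rim (ty s) (pick q)) (rim (ty s) (pick q'))
      joined {zero}  {zero}   q≢q' = contradiction refl q≢q'
      joined {zero}  {suc q'} _    = J-sym (All.head (Leaves.joined-path rest q'))
      joined {suc q} {zero}   _    = All.head (Leaves.joined-path rest q)
      joined {suc q} {suc q'} q≢q' = Leaves.joined rest (q≢q' ∘ cong suc)

    Route : ℕ → Set
    Route s = Σ[ π ∈ List ℕ ] Chain W (centre s) π

    module _ (start : Route s) where
      hubs = branch W (proj₂ start)
      rest = leaves s (proj₂ (proj₂ hubs))

      size : ℕ
      size = proj₁ hubs

      pick : Fin (suc s) → Fin (suc size)
      pick zero    = zero
      pick (suc q) = suc (Leaves.pick rest q)

      selected : Fin (suc s) → ℕ
      selected q = g (ty s) (size , pick q)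

      onward : Route (suc s)
      onward = _ , Leaves.chain rest

      selected-path : ∀ q → All (J (selected q)) (proj₁ start)
      selected-path zero    = proj₁ (proj₂ hubs)
      selected-path (suc q) = All.tail (Leaves.joined-path rest q)

      selected-joined : ∀ {q q'} → q ≢ q' → J (selected q) (selected q')
      selected-joined {zero}  {zero}   q≢q' = contradiction refl q≢q'
      selected-joined {zero}  {suc q'} _    = J-sym (All.head (Leaves.joined-path rest q'))
      selected-joined {suc q} {zero}   _    = All.head (Leaves.joined-path rest q)
      selected-joined {suc q} {suc q'} q≢q' = Leaves.joined rest (q≢q' ∘ cong suc)

      path⊆onward : ∀ {x} → x ∈ proj₁ start → x ∈ proj₁ onward
      path⊆onward = Leaves.extends rest ∘ there

      selected∈onward : ∀ q → selected q ∈ proj₁ onward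
      selected∈onward zero    = Leaves.extends rest (here refl)
      selected∈onward (suc q) = Leaves.pick∈path rest q

      pick-zero : ∀ q → toℕ q ≡ 0 ⇔ toℕ (pick q) ≡ 0
      pick-zero zero    = mk⇔ id id
      pick-zero (suc q) = mk⇔ (λ ()) (λ ())

    module _ (start : Route 0) where

      route : ∀ s → Route s
      route zero    = start
      route (suc s) = onward (route s)

      route-⊆ : ∀ {s s'} → s ≤′ s' → ∀ {x} → x ∈ proj₁ (route s) → x ∈ proj₁ (route s')
      route-⊆ ≤′-refl = id
      route-⊆ {s' = suc s'} (≤′-step s≤s') = path⊆onward (route s') ∘ route-⊆ s≤s'

      -- Stage `s` lies on the path at which stage `s'` begins, and the vertices chosen from there
      -- on are joined to that whole path.
      later : ∀ {s s'} q q' → s < s' → J (selected (route s') q') (selected (route s) q)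
      later {s} {s'} q q' s<s' =
        All.lookup (selected-path (route s') q') (route-⊆ (≤⇒≤′ s<s') (selected∈onward (route s) q))

      all-joined : ∀ {s s'} {q q'} → (s , q) ≢ (s' , q') → J (selected (route s) q) (selected (route s') q')
      all-joined {s} {s'} {q} {q'} ≢ with <-cmp s s'
      ... | tri< s<s' _ _ = J-sym (later q q' s<s')
      ... | tri≈ _ refl _ = selected-joined (route s) (≢ ∘ cong (s ,_))
      ... | tri> _ _ s'<s = later q' q s'<s

  -- What the embedding needs from the strategy: for each stage `s` the centre and `s` further
  -- vertices of one component, all together forming a clique of Maker.
  record Backbone (p : Play) : Set where
    field
      size      : ℕ → ℕ
      pick      : ∀ s → Fin (suc s) → Fin (suc (size s))
      pick-zero : ∀ s q → toℕ q ≡ 0 ⇔ toℕ (pick s q) ≡ 0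

    selected : Σ ℕ (Fin ∘ suc) → ℕ
    selected (s , q) = g (ty s) (size s , pick s q)

    field
      joined : ∀ {a b} → a ≢ b → ClaimedByMaker p (selected a) (selected b)

  open Iterated (λ {P} {P'} → Grown {P} {P'}) initial using (strategy; run; run-related)

  build-backbone : ExcludedMiddle 0ℓ →
    Σ[ σ ∈ Strategy ] (∀ p → Legal p → MakerFollows σ p → Backbone p)
  build-backbone em = strategy round , λ p legal follows →
    let open Limit em (ClaimedByMaker p) (λ { (n , j) → n , Joins-sym {p (2 * n)} j })
        at = run round p legal follows
        start : Route 0
        start = [] , record
          { forest = λ t → proj₁ (proj₁ (proj₂ (at t)))
          ; linked = λ t → let (n , (F , linked , _) , _) = at t in Linked-map (Joined⇒ClaimedByMaker p n) F linked
          ; steps  = λ t → inj₂ (run-related round p legal follows t)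
          ; often  = λ t → t , ≤-refl , run-related round p legal follows t }
    in record
      { size = size ∘ route start ; pick = pick ∘ route start ; pick-zero = pick-zero ∘ route start
      ; joined = all-joined start }

-- Preserving the pattern

within⁻ : ∀ {H j x y} → DisjointUnionAdj H (j , x) (j , y) → Graph.Adj (H j) x y
within⁻ (within _ a) = a

same-component : ∀ {H a b} → DisjointUnionAdj H a b → proj₁ a ≡ proj₁ b
same-component (within _ _) = refl

PreservesZero : ∀ {m n} → (Fin m → Fin n) → Set
PreservesZero φ = ∀ q → toℕ q ≡ 0 ⇔ toℕ (φ q) ≡ 0

-- The common features of stars and cliques: an injection between components that preserves and
-- reflects the centre is an embedding as an induced subgraph.
record Pieces (S : Subgraph) : Set₁ where
  field
    vertex      : Σ ℕ (Fin ∘ suc) → ℕ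
    bijective   : BijectiveOnto vertex (V S)
    R           : ∀ {j} → Rel (Fin (suc j)) 0ℓ
    R-irrefl    : ∀ {j} {q : Fin (suc j)} → ¬ R q q
    R-transfer  : ∀ {j j'} {φ : Fin (suc j) → Fin (suc j')} → Injective _≡_ _≡_ φ → PreservesZero φ →
                  ∀ {q q'} → R q q' ⇔ R (φ q) (φ q')
    R⇒E         : ∀ {j} {q q' : Fin (suc j)} → R q q' → E S (vertex (j , q)) (vertex (j , q'))
    E⇒R         : ∀ {j} {q q' : Fin (suc j)} → E S (vertex (j , q)) (vertex (j , q')) → R q q'
    E⇒same-size : ∀ {a b} → E S (vertex a) (vertex b) → proj₁ a ≡ proj₁ b
  open BijectiveOnto bijective public

clique-transfer : ∀ {m n} {φ : Fin m → Fin n} → Injective _≡_ _≡_ φ → ∀ {q q'} → q ≢ q' ⇔ φ q ≢ φ q'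
clique-transfer φ-inj = mk⇔ (λ q≢q' → q≢q' ∘ φ-inj) (λ φ≢ → φ≢ ∘ cong _)

star-transfer : ∀ {m n} {φ : Fin m → Fin n} → PreservesZero φ →
                ∀ {q q'} → Graph.Adj (star m) q q' ⇔ Graph.Adj (star n) (φ q) (φ q')
star-transfer {φ = φ} zero⇔ = mk⇔ (Sum.map forth forth) (Sum.map back back)
  where
  forth : ∀ {q q'} → toℕ q ≡ 0 × toℕ q' ≢ 0 → toℕ (φ q) ≡ 0 × toℕ (φ q') ≢ 0
  forth {q} {q'} (z , nz) = Equivalence.to (zero⇔ q) z , nz ∘ Equivalence.from (zero⇔ q')
  back : ∀ {q q'} → toℕ (φ q) ≡ 0 × toℕ (φ q') ≢ 0 → toℕ q ≡ 0 × toℕ q' ≢ 0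
  back {q} {q'} (z , nz) = Equivalence.from (zero⇔ q) z , nz ∘ Equivalence.to (zero⇔ q')

pieces : ∀ {S} → (S IsCopyOf G-star) ⊎ (S IsCopyOf G-cli) → Pieces S
pieces (inj₁ (f , bij , adj)) = record
  { vertex = f ; bijective = bij ; R = λ {j} → Graph.Adj (star (suc j))
  ; R-irrefl = λ {j} {q} → Graph.adj-irr (star (suc j)) {q}
  ; R-transfer = λ _ zero⇔ {q} {q'} → star-transfer zero⇔ {q} {q'}
  ; R⇒E = λ {j} r → Equivalence.to (adj _ _) (within j r)
  ; E⇒R = λ e → within⁻ {star ∘ suc} (Equivalence.from (adj _ _) e)
  ; E⇒same-size = λ e → same-component {star ∘ suc} (Equivalence.from (adj _ _) e) }
pieces (inj₂ (f , bij , adj)) = record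
  { vertex = f ; bijective = bij ; R = _≢_
  ; R-irrefl = λ q≢q → q≢q refl
  ; R-transfer = λ φ-inj _ → clique-transfer φ-inj
  ; R⇒E = λ {j} r → Equivalence.to (adj _ _) (within j r)
  ; E⇒R = λ e → within⁻ {clique ∘ suc} (Equivalence.from (adj _ _) e)
  ; E⇒same-size = λ e → same-component {clique ∘ suc} (Equivalence.from (adj _ _) e) }

ClaimedByMaker-irrefl : ∀ {p x y} → ClaimedByMaker p x y → x ≢ y
ClaimedByMaker-irrefl {p} (n , j) = Joins-irrefl {p (2 * n)} j

image : (ℕ → ℕ) → Subgraph
image f = record
  { V = λ v → ∃[ x ] f x ≡ v
  ; E = λ u v → u ≢ v × (∃[ x ] f x ≡ u) × (∃[ y ] f y ≡ v)
  ; E-sym = λ (u≢v , u∈ , v∈) → u≢v ∘ sym , v∈ , u∈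
  ; E-irr = λ (u≢u , _) → u≢u refl
  ; E⇒V = λ (_ , u∈ , _) → u∈ }

-- Slot 0 of the stages serves the vertices outside all G i, slot suc i serves G i.
module Slots (k : ℕ) where

  slot : ℕ → Fin (suc k)
  slot s = s mod suc k

  stage : Fin (suc k) → ℕ → ℕ
  stage r j = toℕ r + j * suc k

  slot-stage : ∀ r j → slot (stage r j) ≡ r
  slot-stage r j = Fin.toℕ-injective (≡-trans (Fin.toℕ-fromℕ< (m%n<n (stage r j) (suc k)))
    (≡-trans ([m+kn]%n≡m%n (toℕ r) j (suc k)) (m<n⇒m%n≡m (Fin.toℕ<n r))))

  stage-injective : ∀ {r r' j j'} → stage r j ≡ stage r' j' → r ≡ r' × j ≡ j'
  stage-injective {r} {r'} {j} {j'} eq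
    with refl ← ≡-trans (sym (slot-stage r j)) (≡-trans (cong slot eq) (slot-stage r' j')) =
    refl , *-cancelʳ-≡ j j' (suc k) (+-cancelˡ-≡ (toℕ r) _ _ eq)

  fits : ∀ r j → suc j ≤ suc (stage r j)
  fits r j = s≤s (≤-trans (m≤m*n j (suc k)) (m≤n+m _ (toℕ r)))

-- Embedding the pattern into Maker's clique

module _ (em : ExcludedMiddle 0ℓ) (k : ℕ) (G : Fin (suc k) → Subgraph)
  (disjoint : ∀ i j → i ≢ j → V (G i) ⊥ V (G j)) (P : ∀ i → Pieces (G i)) where

  open Slots (suc k)
  module P i = Pieces (P i)

  -- Slot `zero` has no graph of its own and borrows components of `G zero`.
  colour : Fin (suc (suc k)) → Fin (suc k)
  colour zero    = zero
  colour (suc i) = i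

  open Construction (suc (suc k)) slot (λ r → P.vertex (colour r)) (λ r → P.injective (colour r))
    using (Backbone; module Backbone; build-backbone)

  -- An outside vertex `x` goes to the centre of a component reserved for it. As nothing else enters
  -- this component, it has no neighbour in the image.
  data Code (x : ℕ) : Fin (suc (suc k)) → Σ ℕ (Fin ∘ suc) → Set where
    member : ∀ {i a} → P.vertex i a ≡ x → Code x (suc i) a
    alone  : (∀ i → ¬ V (G i) x) → Code x zero (x , zero)

  encode : ∀ x → ∃[ r ] ∃[ a ] Code x r a
  encode x with em {∃[ i ] V (G i) x}
  ... | yes (i , v) = let (a , eq) = P.onto i v in suc i , a , member eq
  ... | no  none    = zero , (x , zero) , alone (λ i v → none (i , v))

  Code-injective : ∀ {x y r a} → Code x r a → Code y r a → x ≡ y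
  Code-injective (member refl) (member refl) = refl
  Code-injective (alone _)     (alone _)     = refl

  same-graph : ∀ {i i' x} → V (G i) x → V (G i') x → i ≡ i'
  same-graph {i} {i'} v v' with i Fin.≟ i'
  ... | yes i≡i' = i≡i'
  ... | no  i≢i' = contradiction (v , v') (disjoint i i' i≢i')

  member⁻ : ∀ {x r a i} → V (G i) x → Code x r a → r ≡ suc i × P.vertex i a ≡ x
  member⁻ v (member {i'} {a} refl) with refl ← same-graph v (P.into i' a) = refl , refl
  member⁻ v (alone none) = contradiction v (none _)

  module _ {p : Play} (B : Backbone p) where
    open Backbone B

    selected-injective : ∀ {a b} → selected a ≡ selected b → a ≡ b
    selected-injective {a} {b} eq with em {a ≡ b}
    ... | yes a≡b = a≡b
    ... | no  a≢b = contradiction eq (ClaimedByMaker-irrefl {p} (joined a≢b))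

    position : Fin (suc (suc k)) → Σ ℕ (Fin ∘ suc) → Σ ℕ (Fin ∘ suc)
    position r (j , q) = stage r j , inject≤ q (fits r j)

    position-injective : ∀ {r r' a a'} → position r a ≡ position r' a' → (r , a) ≡ (r' , a')
    position-injective {r} {r'} {j , q} {j' , q'} eq
      with refl , refl ← stage-injective {r} {r'} {j} {j'} (cong proj₁ eq)
      with refl ← Fin.inject≤-injective (fits r j) (fits r j) q q' (,-injectiveʳ-UIP ≡-irrelevant eq) = refl

    f : ℕ → ℕ
    f x = let (r , a , _) = encode x in selected (position r a)

    f-injective : Injective _≡_ _≡_ f
    f-injective {x} {y} eq with encode x | encode y
    ... | r , a , c | r' , a' , c' with refl ← position-injective {r} {r'} {a} {a'} (selected-injective eq) =
      Code-injective c c'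

    φ : ∀ r j → Fin (suc j) → Fin (suc (size (stage r j)))
    φ r j q = pick (stage r j) (inject≤ q (fits r j))

    φ-injective : ∀ r j → Injective _≡_ _≡_ (φ r j)
    φ-injective r j {q} {q'} eq
      with refl ← position-injective {r} {r} {j , q} {j , q'}
                    (selected-injective (cong (λ q → P.vertex _ (_ , q)) eq)) = refl

    φ-zero : ∀ r j → PreservesZero (φ r j)
    φ-zero r j q = subst (λ n → n ≡ 0 ⇔ toℕ (φ r j q) ≡ 0) (Fin.toℕ-inject≤ q (fits r j)) (pick-zero _ _)

    selected-position : ∀ r j q → selected (position r (j , q)) ≡ P.vertex (colour r) (size (stage r j) , φ r j q)
    selected-position r j q = cong (λ r' → P.vertex (colour r') (size (stage r j) , φ r j q)) (slot-stage r j)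

    -- Centres go to centres, so two stages with the same component of the same graph would both
    -- select its hub, against injectivity.
    same-star : ∀ {r r' j j'} → colour r ≡ colour r' → size (stage r j) ≡ size (stage r' j') → r ≡ r' × j ≡ j'
    same-star {r} {r'} {j} {j'} colour≡ size≡ = stage-injective {r} {r'}
      (cong proj₁ (selected-injective {position r (j , zero)} {position r' (j' , zero)}
        (≡-trans (hub r j) (≡-trans (cong₂ (λ i n → P.vertex i (n , zero)) colour≡ size≡) (sym (hub r' j'))))))
      where
      hub : ∀ r j → selected (position r (j , zero)) ≡ P.vertex (colour r) (size (stage r j) , zero)
      hub r j = ≡-trans (selected-position r j zero)
        (cong (λ q → P.vertex (colour r) (_ , q)) (Fin.toℕ-injective (Equivalence.to (φ-zero r j zero) refl)))

    preserved : ∀ {i x y} {r r' a a'} → Code x r a → Code y r' a' → E (G i) x y →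
                E (G i) (selected (position r a)) (selected (position r' a'))
    preserved {i} c c' e with refl , refl ← member⁻ (Subgraph.E⇒V (G i) e) c
                            | refl , refl ← member⁻ (Subgraph.E⇒V (G i) (Subgraph.E-sym (G i) e)) c'
      -- Adjacent vertices share a component, hence a stage, and `φ` carries the edge over.
      with refl ← P.E⇒same-size i e =
      subst₂ (E (G i)) (sym (selected-position _ _ _)) (sym (selected-position _ _ _))
        (P.R⇒E i (Equivalence.to (P.R-transfer i (φ-injective _ _) (φ-zero _ _)) (P.E⇒R i e)))

    reflected : ∀ {i x y} {r r' a a'} → Code x r a → Code y r' a' →
                E (G i) (selected (position r a)) (selected (position r' a')) → E (G i) x y
    reflected {i} {r = r} {r'} {j , q} {j' , q'} c c' e
      with e' ← subst₂ (E (G i)) (selected-position r j q) (selected-position r' j' q') e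
      with refl ← same-graph (Subgraph.E⇒V (G i) e') (P.into (colour r) _)
      with eq ← same-graph (P.into (colour r') _) (Subgraph.E⇒V (G i) (Subgraph.E-sym (G i) e'))
      -- Adjacent images share a component, which determines the stage; thus slot `zero` cannot be
      -- confused with the slot of `G zero`.
      with refl , refl ← same-star {r} {r'} {j} {j'} (sym eq)
             (P.E⇒same-size i {_ , φ r j q} {_ , φ r' j' q'} (subst (λ i' → E (G i) _ (P.vertex i' _)) eq e'))
      = decode c c' (Equivalence.from (P.R-transfer i (φ-injective r j) (φ-zero r j)) (P.E⇒R i e'))
      where
      decode : ∀ {r x y j q q'} → Code x r (j , q) → Code y r (j , q') → P.R (colour r) q q' → E (G (colour r)) x y
      decode (member {i} refl) (member refl) r = P.R⇒E i r
      -- Both codes name the same vertex `zero`, which is not adjacent to itself.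
      decode (alone _)         (alone _)     r = contradiction r (P.R-irrefl zero)

    wins : MakerWins G p
    -- The same `f` enumerates the clique and preserves the pattern.
    wins = image f , (f , bijective , λ x y → mk⇔ (λ x≢y → x≢y ∘ f-injective , (x , refl) , (y , refl))
                                                   (λ (f≢ , _) x≡y → f≢ (cong f x≡y))) ,
      claimed , f , bijective , λ x y i →
        let (_ , _ , c) = encode x ; (_ , _ , c') = encode y in mk⇔ (preserved c c') (reflected c c')
      where
      bijective : BijectiveOnto f (V (image f))
      bijective = record { into = λ x → x , refl ; injective = f-injective ; onto = id }
      claimed : ∀ {u v} → E (image f) u v → ClaimedByMaker p u v
      claimed (u≢v , (x , refl) , (y , refl)) = joined (u≢v ∘ cong selected)

  maker-wins : MakerHasWinningStrategy G
  maker-wins = let (σ , backbone) = build-backbone em in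
    σ , λ p legal follows → wins (backbone p legal follows)

corollary1p2 : ExcludedMiddle 0ℓ →
    (k : ℕ) → .{{_ : NonZero k}} →
    (G : Fin k → Subgraph) →
    (∀ i j → i ≢ j → V (G i) ⊥ V (G j)) →
    (∀ i → (G i IsCopyOf G-star) ⊎ (G i IsCopyOf G-cli)) →
    MakerHasWinningStrategy G
corollary1p2 em (suc k) G disjoint copies = maker-wins em k G disjoint (λ i → pieces (copies i))
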